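{- There exist oriented matroids of rank $3$ on $13$ points whose realization spaces are disconnected.
   Context: Let $E=\{1,\dots,n\}$ and let $r\ge 1$ be an integer. An oriented matroid $\mathcal{M}=\mathcal{M}(E,\chi)$ of rank $r$ on $E$ (that is, on $n$ points) is defined by a map $\chi:E^r\to\{ -1,0,+1\}$, called its chirotope, such that: (1) $\chi$ is not identically zero; (2) $\chi$ is alternating: $\chi(i_{\sigma(1)},\dots,i_{\sigma(r)})=\operatorname{sgn}(\sigma)\,\chi(i_1,\dots,i_r)$ for all $i_1,\dots,i_r\in E$ and all permutations $\sigma$ of $\{1,\dots,r\}$; (3) for all $i_1,\dots,i_r,j_1,\dots,j_r\in E$ such that $\chi(j_k,i_2,\dots,i_r)\cdot\chi(j_1,\dots,j_{k-1},i_1,j_{k+1},\dots,j_r)\ge 0$ for every $k=1,\dots,r$, we have $\chi(i_1,\dots,i_r)\cdot\chi(j_1,\dots,j_r)\ge 0$. For a real $r\times n$ matrix $X=(x_1,\dots,x_n)$ of rank $r$ with columns $x_i\in\mathbb{R}^r$, its chirotope is $\chi_X:E^r\to\{ -1,0,+1\}$, $\chi_X(i_1,\dots,i_r)=\operatorname{sgn}\det(x_{i_1},\dots,x_{i_r})$. A realization of $\mathcal{M}(E,\chi)$ is a real $r\times n$ matrix $X$ of rank $r$ with $\chi_X=\chi$ or $\chi_X=-\chi$. Two realizations $X,X'$ are linearly equivalent if $X'=AX$ for some $A\in GL(r,\mathbb{R})$. The realization space $\mathcal{R}(\mathcal{M})$ is the set of all linear equivalence classes of realizations of $\mathcal{M}$,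 with the quotient topology induced from $\mathbb{R}^{rn}$ (the set of realizations carrying the subspace topology). -}

module Defs where

open import Algebra.Bundles using (CommutativeRing)
import Algebra.Properties.Semiring.Exp as SemiringExp
import Algebra.Properties.Semiring.Sum as SemiringSum
open import Data.Fin.Base using (Fin; zero; suc; toℕ; punchIn)
open import Data.Fin.Permutation using (Permutation′; _⟨$⟩ʳ_)
open import Data.Fin.Properties using (_<?_)
open import Data.List.Base using (List; allFin; cartesianProduct; filter; foldr)
open import Data.Nat.Base using (ℕ; zero; suc; NonZero; _⊔_) renaming (_≤_ to _≤ⁿ_)
import Data.Nat.Properties as ℕₚ
open import Data.Product.Base using (Σ; Σ-syntax; ∃-syntax; _×_; _,_; proj₁; proj₂)
open import Data.Rational.Base as ℚ
  using (ℚ; 0ℚ; 1ℚ; ½; ∣_∣; 1/_; positive; nonNegative)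
import Data.Rational.Properties as ℚₚ
open import Data.Rational.Solver using (module +-*-Solver)
open import Data.Sum.Base using (_⊎_)
open import Data.Vec.Base using (Vec; lookup; tabulate; _[_]≔_)
open import Function.Bundles using (_⇔_)
open import Level using (Level; 0ℓ) renaming (suc to lsuc; _⊔_ to _⊔ˡ_)
open import Relation.Binary.Bundles using (Setoid)
open import Relation.Binary.Core using (Rel; _⇒_)
open import Relation.Binary.Definitions using (_Respects_)
import Relation.Binary.Construct.On as On
open import Relation.Binary.PropositionalEquality as ≡ using (_≡_; _≢_)
import Relation.Binary.Reasoning.Setoid as SetoidReasoning
open import Relation.Binary.Structures using (IsEquivalence)
open import Relation.Nullary.Decidable using (_×-dec_)
open import Relation.Nullary.Negation.Core using (¬_)
open import Relation.Unary using (Pred)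

-- Reals are Cauchy sequences of rationals; their equality is _≈ᴿ_, not _≡_.
Small : ℚ → ℚ → Set
Small ε q = ∣ q ∣ ℚ.< ε

Eventually : (ℕ → Set) → Set
Eventually P = ∃[ N ] (∀ n → N ≤ⁿ n → P n)

record ℝ : Set where
  constructor mkℝ
  field
    seq    : ℕ → ℚ
    cauchy : ∀ ε → 0ℚ ℚ.< ε →
             ∃[ N ] (∀ m n → N ≤ⁿ m → N ≤ⁿ n → Small ε (seq m ℚ.- seq n))

open ℝ public

infix 4 _≈ᴿ_ _<ᴿ_

_≈ᴿ_ : Rel ℝ 0ℓ
x ≈ᴿ y = ∀ ε → 0ℚ ℚ.< ε → Eventually λ n → Small ε (seq x n ℚ.- seq y n)

_<ᴿ_ : Rel ℝ 0ℓ
x <ᴿ y = ∃[ ε ] (0ℚ ℚ.< ε × Eventually λ n → seq x n ℚ.+ ε ℚ.< seq y n)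

private
  half : ℚ → ℚ
  half ε = ½ ℚ.* ε

  half-pos : ∀ {ε} → 0ℚ ℚ.< ε → 0ℚ ℚ.< half ε
  half-pos {ε} p = ℚₚ.positive⁻¹ (half ε)
    {{ℚₚ.pos*pos⇒pos ½ ε {{positive p}}}}

  half+half : ∀ ε → half ε ℚ.+ half ε ≡ ε
  half+half ε = ≡.trans (≡.sym (ℚₚ.*-distribʳ-+ ε ½ ½)) (ℚₚ.*-identityˡ ε)

  small-+ : ∀ {ε p q} → Small (half ε) p → Small (half ε) q → Small ε (p ℚ.+ q)
  small-+ {ε} {p} {q} a b = ℚₚ.≤-<-trans (ℚₚ.∣p+q∣≤∣p∣+∣q∣ p q)
    (≡.subst (∣ p ∣ ℚ.+ ∣ q ∣ ℚ.<_) (half+half ε) (ℚₚ.+-mono-< a b))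

  small-neg : ∀ {ε p} → Small ε p → Small ε (ℚ.- p)
  small-neg {ε} {p} = ≡.subst (ℚ._< ε) (≡.sym (ℚₚ.∣-p∣≡∣p∣ p))

  small-0 : ∀ {ε q} → 0ℚ ℚ.< ε → q ≡ 0ℚ → Small ε q
  small-0 p ≡.refl = p

  abs-pos-bound : ∀ {B q} → Small B q → 0ℚ ℚ.< B
  abs-pos-bound {q = q} = ℚₚ.≤-<-trans (ℚₚ.0≤∣p∣ q)

  scale : ∀ B → 0ℚ ℚ.< B → ℚ → ℚ
  scale B p ε = (1/ B) {{ℚₚ.pos⇒nonZero B {{positive p}}}} ℚ.* ε

  scale-pos : ∀ B p {ε} → 0ℚ ℚ.< ε → 0ℚ ℚ.< scale B p ε
  scale-pos B p {ε} q = ℚₚ.positive⁻¹ (scale B p ε)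
    {{ℚₚ.pos*pos⇒pos ((1/ B) {{ℚₚ.pos⇒nonZero B {{positive p}}}})
        {{ℚₚ.1/pos⇒pos B {{positive p}}}} ε {{positive q}}}}

  *-scale : ∀ B p ε → B ℚ.* scale B p ε ≡ ε
  *-scale B p ε = ≡.trans (≡.sym (ℚₚ.*-assoc B _ ε))
    (≡.trans (≡.cong (ℚ._* ε) (ℚₚ.*-inverseʳ B {{ℚₚ.pos⇒nonZero B {{positive p}}}}))
             (ℚₚ.*-identityˡ ε))

  small-* : ∀ {B} (p : 0ℚ ℚ.< B) {ε a d} →
            Small B a → Small (scale B p ε) d → Small ε (a ℚ.* d)
  small-* {B} p {ε} {a} {d} Ba δd = ≡.subst (ℚ._< ε) (≡.sym (ℚₚ.∣p*q∣≡∣p∣*∣q∣ a d))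
    (ℚₚ.≤-<-trans
      (ℚₚ.*-monoʳ-≤-nonNeg ∣ d ∣ {{nonNegative (ℚₚ.0≤∣p∣ d)}} (ℚₚ.<⇒≤ Ba))
      (≡.subst (B ℚ.* ∣ d ∣ ℚ.<_) (*-scale B p ε)
        (ℚₚ.*-monoʳ-<-pos B {{positive p}} δd)))

  sub-+ : ∀ a b c d → (a ℚ.- c) ℚ.+ (b ℚ.- d) ≡ (a ℚ.+ b) ℚ.- (c ℚ.+ d)
  sub-+ = solve 4 (λ a b c d → (a :- c) :+ (b :- d) := (a :+ b) :- (c :+ d)) ≡.refl
    where open +-*-Solver

  sub-neg : ∀ a b → ℚ.- (a ℚ.- b) ≡ (ℚ.- a) ℚ.- (ℚ.- b)
  sub-neg = solve 2 (λ a b → :- (a :- b) := (:- a) :- (:- b)) ≡.refl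
    where open +-*-Solver

  sub-swap : ∀ a b → ℚ.- (a ℚ.- b) ≡ b ℚ.- a
  sub-swap = solve 2 (λ a b → :- (a :- b) := b :- a) ≡.refl
    where open +-*-Solver

  sub-trans : ∀ a b c → (a ℚ.- b) ℚ.+ (b ℚ.- c) ≡ a ℚ.- c
  sub-trans = solve 3 (λ a b c → (a :- b) :+ (b :- c) := a :- c) ≡.refl
    where open +-*-Solver

  sub-* : ∀ a b c d → a ℚ.* (b ℚ.- d) ℚ.+ d ℚ.* (a ℚ.- c) ≡ a ℚ.* b ℚ.- c ℚ.* d
  sub-* = solve 4 (λ a b c d → a :* (b :- d) :+ d :* (a :- c) := a :* b :- c :* d) ≡.refl
    where open +-*-Solver

  small-*-sub : ∀ {B C} (p : 0ℚ ℚ.< B) (q : 0ℚ ℚ.< C) ε a b c d →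
                Small B a → Small C d →
                Small (scale B p (half ε)) (b ℚ.- d) → Small (scale C q (half ε)) (a ℚ.- c) →
                Small ε (a ℚ.* b ℚ.- c ℚ.* d)
  small-*-sub p q ε a b c d Ba Cd bd ac = ≡.subst (Small ε) (sub-* a b c d)
    (small-+ {ε} {a ℚ.* (b ℚ.- d)} {d ℚ.* (a ℚ.- c)}
      (small-* p {half ε} {a} {b ℚ.- d} Ba bd)
      (small-* q {half ε} {d} {a ℚ.- c} Cd ac))

  sub-add : ∀ a b → (a ℚ.- b) ℚ.+ b ≡ a
  sub-add = solve 2 (λ a b → (a :- b) :+ b := a) ≡.refl
    where open +-*-Solver

  bound : ∀ x → ∃[ B ] Eventually λ n → Small B (seq x n)
  bound x with cauchy x 1ℚ (ℚₚ.positive⁻¹ 1ℚ)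
  ... | N , c = 1ℚ ℚ.+ ∣ seq x N ∣ , N , λ n N≤n →
    ≡.subst (Small (1ℚ ℚ.+ ∣ seq x N ∣)) (sub-add (seq x n) (seq x N))
      (ℚₚ.≤-<-trans (ℚₚ.∣p+q∣≤∣p∣+∣q∣ (seq x n ℚ.- seq x N) (seq x N))
        (ℚₚ.+-monoˡ-< ∣ seq x N ∣ (c n N N≤n ℕₚ.≤-refl)))

  bound-pos : ∀ x → 0ℚ ℚ.< proj₁ (bound x)
  bound-pos x = abs-pos-bound (proj₂ (proj₂ (bound x)) _ ℕₚ.≤-refl)

  ≤-left : ∀ {a b n} → a ⊔ b ≤ⁿ n → a ≤ⁿ n
  ≤-left {a} {b} = ℕₚ.≤-trans (ℕₚ.m≤m⊔n a b)

  ≤-right : ∀ {a b n} → a ⊔ b ≤ⁿ n → b ≤ⁿ n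
  ≤-right {a} {b} = ℕₚ.≤-trans (ℕₚ.m≤n⊔m a b)

infixl 6 _+ᴿ_
infixl 7 _*ᴿ_
infix  8 -ᴿ_

_+ᴿ_ : ℝ → ℝ → ℝ
seq    (x +ᴿ y) n = seq x n ℚ.+ seq y n
cauchy (x +ᴿ y) ε p with cauchy x (half ε) (half-pos p) | cauchy y (half ε) (half-pos p)
... | M , c | N , d = M ⊔ N , λ m n q r →
  ≡.subst (Small ε) (sub-+ (seq x m) (seq y m) (seq x n) (seq y n))
    (small-+ {ε} (c m n (≤-left q) (≤-left r)) (d m n (≤-right {M} q) (≤-right {M} r)))

-ᴿ_ : ℝ → ℝ
seq    (-ᴿ x) n = ℚ.- seq x n
cauchy (-ᴿ x) ε p with cauchy x ε p
... | N , c = N , λ m n q r →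
  ≡.subst (Small ε) (sub-neg (seq x m) (seq x n)) (small-neg (c m n q r))

private
  IsCauchy : (ℕ → ℚ) → ℚ → Set
  IsCauchy s ε = ∃[ N ] (∀ m n → N ≤ⁿ m → N ≤ⁿ n → Small ε (s m ℚ.- s n))

  *-cauchy : ∀ (s t : ℕ → ℚ) B C (B>0 : 0ℚ ℚ.< B) (C>0 : 0ℚ ℚ.< C) ε →
             Eventually (λ n → Small B (s n)) → Eventually (λ n → Small C (t n)) →
             IsCauchy t (scale B B>0 (half ε)) → IsCauchy s (scale C C>0 (half ε)) →
             IsCauchy (λ n → s n ℚ.* t n) ε
  *-cauchy s t B C B>0 C>0 ε (K , b) (L , c) (M , d) (N , e) =
    (K ⊔ L) ⊔ (M ⊔ N) , λ m n q r →
      small-*-sub B>0 C>0 ε (s m) (t m) (s n) (t n)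
        (b m (≤-left {K} {L} (≤-left {K ⊔ L} {M ⊔ N} q)))
        (c n (≤-right {K} {L} (≤-left {K ⊔ L} {M ⊔ N} r)))
        (d m n (≤-left {M} {N} (≤-right {K ⊔ L} q)) (≤-left {M} {N} (≤-right {K ⊔ L} r)))
        (e m n (≤-right {M} (≤-right {K ⊔ L} q)) (≤-right {M} (≤-right {K ⊔ L} r)))

_*ᴿ_ : ℝ → ℝ → ℝ
seq    (x *ᴿ y) n = seq x n ℚ.* seq y n
cauchy (x *ᴿ y) ε p =
  *-cauchy (seq x) (seq y) B C B>0 C>0 ε (proj₂ (bound x)) (proj₂ (bound y))
    (cauchy y _ (scale-pos B B>0 (half-pos p)))
    (cauchy x _ (scale-pos C C>0 (half-pos p)))
  where
  B = proj₁ (bound x)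
  C = proj₁ (bound y)
  B>0 = bound-pos x
  C>0 = bound-pos y

fromℚ : ℚ → ℝ
seq    (fromℚ q) n = q
cauchy (fromℚ q) ε p = 0 , λ m n _ _ → small-0 p (ℚₚ.+-inverseʳ q)

0ᴿ 1ᴿ : ℝ
0ᴿ = fromℚ 0ℚ
1ᴿ = fromℚ 1ℚ

pointwise⇒≈ᴿ : ∀ x y → (∀ n → seq x n ≡ seq y n) → x ≈ᴿ y
pointwise⇒≈ᴿ x y eq ε p = 0 , λ n _ →
  small-0 p (≡.trans (≡.cong (ℚ._- seq y n) (eq n)) (ℚₚ.+-inverseʳ (seq y n)))

≈ᴿ-isEquivalence : IsEquivalence _≈ᴿ_
≈ᴿ-isEquivalence = record
  { refl  = λ {x} → pointwise⇒≈ᴿ x x (λ _ → ≡.refl)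
  ; sym   = λ {x} {y} x≈y ε p → let N , c = x≈y ε p in N , λ n q →
      ≡.subst (Small ε) (sub-swap (seq x n) (seq y n)) (small-neg (c n q))
  ; trans = λ {x} {y} {z} x≈y y≈z ε p →
      let M , c = x≈y (half ε) (half-pos p)
          N , d = y≈z (half ε) (half-pos p)
      in M ⊔ N , λ n q →
        ≡.subst (Small ε) (sub-trans (seq x n) (seq y n) (seq z n))
          (small-+ {ε} (c n (≤-left q)) (d n (≤-right {M} q)))
  }

+ᴿ-cong : ∀ {x y u v} → x ≈ᴿ y → u ≈ᴿ v → x +ᴿ u ≈ᴿ y +ᴿ v
+ᴿ-cong {x} {y} {u} {v} x≈y u≈v ε p =
  let M , c = x≈y (half ε) (half-pos p)
      N , d = u≈v (half ε) (half-pos p)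
  in M ⊔ N , λ n q →
    ≡.subst (Small ε) (sub-+ (seq x n) (seq u n) (seq y n) (seq v n))
      (small-+ {ε} (c n (≤-left q)) (d n (≤-right {M} q)))

-ᴿ-cong : ∀ {x y} → x ≈ᴿ y → -ᴿ x ≈ᴿ -ᴿ y
-ᴿ-cong {x} {y} x≈y ε p = let N , c = x≈y ε p in N , λ n q →
  ≡.subst (Small ε) (sub-neg (seq x n) (seq y n)) (small-neg (c n q))

private
  *-close : ∀ (s t u v : ℕ → ℚ) B C (B>0 : 0ℚ ℚ.< B) (C>0 : 0ℚ ℚ.< C) ε →
            Eventually (λ n → Small B (s n)) → Eventually (λ n → Small C (v n)) →
            Eventually (λ n → Small (scale B B>0 (half ε)) (u n ℚ.- v n)) →
            Eventually (λ n → Small (scale C C>0 (half ε)) (s n ℚ.- t n)) →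
            Eventually (λ n → Small ε (s n ℚ.* u n ℚ.- t n ℚ.* v n))
  *-close s t u v B C B>0 C>0 ε (K , b) (L , c) (M , d) (N , e) =
    (K ⊔ L) ⊔ (M ⊔ N) , λ n q →
      small-*-sub B>0 C>0 ε (s n) (u n) (t n) (v n)
        (b n (≤-left {K} {L} (≤-left {K ⊔ L} {M ⊔ N} q)))
        (c n (≤-right {K} {L} (≤-left {K ⊔ L} {M ⊔ N} q)))
        (d n (≤-left {M} {N} (≤-right {K ⊔ L} q)))
        (e n (≤-right {M} (≤-right {K ⊔ L} q)))

*ᴿ-cong : ∀ {x y u v} → x ≈ᴿ y → u ≈ᴿ v → x *ᴿ u ≈ᴿ y *ᴿ v
*ᴿ-cong {x} {y} {u} {v} x≈y u≈v ε p =
  *-close (seq x) (seq y) (seq u) (seq v) _ _ (bound-pos x) (bound-pos v) ε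
    (proj₂ (bound x)) (proj₂ (bound v))
    (u≈v _ (scale-pos _ (bound-pos x) (half-pos p)))
    (x≈y _ (scale-pos _ (bound-pos v) (half-pos p)))

ℝ-commutativeRing : CommutativeRing 0ℓ 0ℓ
ℝ-commutativeRing = record
  { Carrier = ℝ
  ; _≈_ = _≈ᴿ_
  ; _+_ = _+ᴿ_
  ; _*_ = _*ᴿ_
  ; -_ = -ᴿ_
  ; 0# = 0ᴿ
  ; 1# = 1ᴿ
  ; isCommutativeRing = record
    { isRing = record
      { +-isAbelianGroup = record
        { isGroup = record
          { isMonoid = record
            { isSemigroup = record
              { isMagma = record
                { isEquivalence = ≈ᴿ-isEquivalence
                ; ∙-cong = λ {x} {y} {u} {v} → +ᴿ-cong {x} {y} {u} {v}
                }
              ; assoc = λ x y z → pointwise⇒≈ᴿ ((x +ᴿ y) +ᴿ z) (x +ᴿ (y +ᴿ z))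
                  (λ n → ℚₚ.+-assoc (seq x n) (seq y n) (seq z n))
              }
            ; identity = (λ x → pointwise⇒≈ᴿ (0ᴿ +ᴿ x) x (λ n → ℚₚ.+-identityˡ (seq x n)))
                       , (λ x → pointwise⇒≈ᴿ (x +ᴿ 0ᴿ) x (λ n → ℚₚ.+-identityʳ (seq x n)))
            }
          ; inverse = (λ x → pointwise⇒≈ᴿ ((-ᴿ x) +ᴿ x) 0ᴿ (λ n → ℚₚ.+-inverseˡ (seq x n)))
                    , (λ x → pointwise⇒≈ᴿ (x +ᴿ (-ᴿ x)) 0ᴿ (λ n → ℚₚ.+-inverseʳ (seq x n)))
          ; ⁻¹-cong = λ {x} {y} → -ᴿ-cong {x} {y}
          }
        ; comm = λ x y → pointwise⇒≈ᴿ (x +ᴿ y) (y +ᴿ x)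
            (λ n → ℚₚ.+-comm (seq x n) (seq y n))
        }
      ; *-cong = λ {x} {y} {u} {v} → *ᴿ-cong {x} {y} {u} {v}
      ; *-assoc = λ x y z → pointwise⇒≈ᴿ ((x *ᴿ y) *ᴿ z) (x *ᴿ (y *ᴿ z))
          (λ n → ℚₚ.*-assoc (seq x n) (seq y n) (seq z n))
      ; *-identity = (λ x → pointwise⇒≈ᴿ (1ᴿ *ᴿ x) x (λ n → ℚₚ.*-identityˡ (seq x n)))
                   , (λ x → pointwise⇒≈ᴿ (x *ᴿ 1ᴿ) x (λ n → ℚₚ.*-identityʳ (seq x n)))
      ; distrib = (λ x y z → pointwise⇒≈ᴿ (x *ᴿ (y +ᴿ z)) ((x *ᴿ y) +ᴿ (x *ᴿ z))
                     (λ n → ℚₚ.*-distribˡ-+ (seq x n) (seq y n) (seq z n)))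
                , (λ x y z → pointwise⇒≈ᴿ ((y +ᴿ z) *ᴿ x) ((y *ᴿ x) +ᴿ (z *ᴿ x))
                     (λ n → ℚₚ.*-distribʳ-+ (seq x n) (seq y n) (seq z n)))
      }
    ; *-comm = λ x y → pointwise⇒≈ᴿ (x *ᴿ y) (y *ᴿ x)
        (λ n → ℚₚ.*-comm (seq x n) (seq y n))
    }
  }

module Matrices {c ℓ : Level} (R : CommutativeRing c ℓ) where
  open CommutativeRing R hiding (zero)
  open SemiringSum semiring using (sum; sum-cong-≋; *-distribˡ-sum; *-distribʳ-sum; ∑-comm;
    sum-replicate-zero)
  open SemiringExp semiring using (_^_)

  Matrix : ℕ → ℕ → Set c
  Matrix m n = Fin m → Fin n → Carrier

  infix  4 _≋_
  infixl 7 _⊠_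

  _≋_ : ∀ {m n} → Rel (Matrix m n) ℓ
  X ≋ Y = ∀ i j → X i j ≈ Y i j

  _⊠_ : ∀ {k m n} → Matrix k m → Matrix m n → Matrix k n
  (X ⊠ Y) i j = sum λ l → X i l * Y l j

  𝟙 : ∀ {n} → Matrix n n
  𝟙 zero    zero    = 1#
  𝟙 zero    (suc j) = 0#
  𝟙 (suc i) zero    = 0#
  𝟙 (suc i) (suc j) = 𝟙 i j

  -- Laplace expansion along the first row.
  det : ∀ {n} → Matrix n n → Carrier
  det {zero}  X = 1#
  det {suc n} X = sum λ j →
    ((- 1#) ^ toℕ j) * (X zero j * det λ i k → X (suc i) (punchIn j k))

  Invertible : ∀ {n} → Matrix n n → Set (c ⊔ˡ ℓ)
  Invertible A = ∃[ B ] (A ⊠ B ≋ 𝟙 × B ⊠ A ≋ 𝟙)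

  columns : ∀ {m n k} → Matrix m n → Vec (Fin n) k → Matrix m k
  columns X s i l = X i (lookup s l)

  LinearlyIndependent : ∀ {m k} → Matrix m k → Set (c ⊔ˡ ℓ)
  LinearlyIndependent {k = k} X = (a : Fin k → Carrier) →
    (∀ i → sum (λ l → X i l * a l) ≈ 0#) → ∀ l → a l ≈ 0#

  -- Some k of the columns form a basis of the column space.
  HasRank : ∀ {m n} → Matrix m n → ℕ → Set (c ⊔ˡ ℓ)
  HasRank {n = n} X k = Σ[ s ∈ Vec (Fin n) k ] (LinearlyIndependent (columns X s) ×
    (∀ j → Σ[ a ∈ (Fin k → Carrier) ] (∀ i → X i j ≈ sum λ l → columns X s i l * a l)))

  ≋-isEquivalence : ∀ {m n} → IsEquivalence (_≋_ {m} {n})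
  ≋-isEquivalence = record
    { refl  = λ i j → refl
    ; sym   = λ p i j → sym (p i j)
    ; trans = λ p q i j → trans (p i j) (q i j)
    }

  ≋-setoid : ℕ → ℕ → Setoid c ℓ
  ≋-setoid m n = record { isEquivalence = ≋-isEquivalence {m} {n} }

  ⊠-cong : ∀ {k m n} {X X′ : Matrix k m} {Y Y′ : Matrix m n} →
           X ≋ X′ → Y ≋ Y′ → X ⊠ Y ≋ X′ ⊠ Y′
  ⊠-cong p q i j = sum-cong-≋ λ l → *-cong (p i l) (q l j)

  ⊠-identityˡ : ∀ {m n} (X : Matrix m n) → 𝟙 ⊠ X ≋ X
  ⊠-identityˡ {suc m} X zero j = trans
    (+-cong (*-identityˡ _) (trans (sum-cong-≋ λ l → zeroˡ (X (suc l) j)) (sum-replicate-zero m)))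
    (+-identityʳ _)
  ⊠-identityˡ {suc m} X (suc i) j = trans
    (+-cong (zeroˡ _) (⊠-identityˡ (λ i → X (suc i)) i j)) (+-identityˡ _)

  ⊠-assoc : ∀ {k l m n} (X : Matrix k l) (Y : Matrix l m) (Z : Matrix m n) →
            (X ⊠ Y) ⊠ Z ≋ X ⊠ (Y ⊠ Z)
  ⊠-assoc X Y Z i j = begin
    sum (λ b → sum (λ a → X i a * Y a b) * Z b j)
      ≈⟨ (sum-cong-≋ λ b → *-distribʳ-sum (Z b j) (λ a → X i a * Y a b)) ⟩
    sum (λ b → sum (λ a → X i a * Y a b * Z b j))
      ≈⟨ ∑-comm (λ b a → X i a * Y a b * Z b j) ⟩
    sum (λ a → sum (λ b → X i a * Y a b * Z b j))
      ≈⟨ (sum-cong-≋ λ a → sum-cong-≋ λ b → *-assoc (X i a) (Y a b) (Z b j)) ⟩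
    sum (λ a → sum (λ b → X i a * (Y a b * Z b j)))
      ≈⟨ (sum-cong-≋ λ a → *-distribˡ-sum (X i a) (λ b → Y a b * Z b j)) ⟨
    sum (λ a → X i a * sum (λ b → Y a b * Z b j)) ∎
    where open SetoidReasoning setoid

  LinearlyEquivalent : ∀ {r n} → Rel (Matrix r n) (c ⊔ˡ ℓ)
  LinearlyEquivalent X X′ = ∃[ A ] (Invertible A × X′ ≋ A ⊠ X)

  ≋⇒LinearlyEquivalent : ∀ {r n} {X Y : Matrix r n} → X ≋ Y → LinearlyEquivalent X Y
  ≋⇒LinearlyEquivalent {X = X} p =
    𝟙 , (𝟙 , ⊠-identityˡ 𝟙 , ⊠-identityˡ 𝟙) ,
    λ i j → trans (sym (p i j)) (sym (⊠-identityˡ X i j))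

  private
    Invertible-⊠ : ∀ {n} {A B : Matrix n n} → Invertible A → Invertible B → Invertible (A ⊠ B)
    Invertible-⊠ {n} {A} {B} (A⁻¹ , AA⁻¹ , A⁻¹A) (B⁻¹ , BB⁻¹ , B⁻¹B) =
      B⁻¹ ⊠ A⁻¹ , cancel A B B⁻¹ A⁻¹ BB⁻¹ AA⁻¹ , cancel B⁻¹ A⁻¹ A B A⁻¹A B⁻¹B
      where
      open SetoidReasoning (≋-setoid n n)
      cancel : (P Q Q′ P′ : Matrix n n) → Q ⊠ Q′ ≋ 𝟙 → P ⊠ P′ ≋ 𝟙 →
               (P ⊠ Q) ⊠ (Q′ ⊠ P′) ≋ 𝟙
      cancel P Q Q′ P′ q p = begin
        (P ⊠ Q) ⊠ (Q′ ⊠ P′)  ≈⟨ ⊠-assoc P Q (Q′ ⊠ P′) ⟩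
        P ⊠ (Q ⊠ (Q′ ⊠ P′))  ≈⟨ ⊠-cong {X = P} (λ _ _ → refl) (⊠-assoc Q Q′ P′) ⟨
        P ⊠ ((Q ⊠ Q′) ⊠ P′)  ≈⟨ ⊠-cong {X = P} (λ _ _ → refl) (⊠-cong {Y = P′} q (λ _ _ → refl)) ⟩
        P ⊠ (𝟙 ⊠ P′)         ≈⟨ ⊠-cong {X = P} (λ _ _ → refl) (⊠-identityˡ P′) ⟩
        P ⊠ P′               ≈⟨ p ⟩
        𝟙                    ∎

  LinearlyEquivalent-isEquivalence : ∀ {r n} → IsEquivalence (LinearlyEquivalent {r} {n})
  LinearlyEquivalent-isEquivalence {r} {n} = record
    { refl  = λ {X} → ≋⇒LinearlyEquivalent {X = X} {Y = X} (λ _ _ → refl)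
    ; sym   = λ {X} {Y} (A , (B , AB , BA) , Y≋AX) → B , (A , BA , AB) , (begin
        X            ≈⟨ ⊠-identityˡ X ⟨
        𝟙 ⊠ X        ≈⟨ ⊠-cong {Y = X} BA (λ _ _ → refl) ⟨
        (B ⊠ A) ⊠ X  ≈⟨ ⊠-assoc B A X ⟩
        B ⊠ (A ⊠ X)  ≈⟨ ⊠-cong {X = B} (λ _ _ → refl) Y≋AX ⟨
        B ⊠ Y        ∎)
    ; trans = λ {X} {Y} {Z} (A , A-inv , Y≋AX) (B , B-inv , Z≋BY) →
        B ⊠ A , Invertible-⊠ B-inv A-inv , (begin
        Z            ≈⟨ Z≋BY ⟩
        B ⊠ Y        ≈⟨ ⊠-cong {X = B} (λ _ _ → refl) Y≋AX ⟩
        B ⊠ (A ⊠ X)  ≈⟨ ⊠-assoc B A X ⟨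
        (B ⊠ A) ⊠ X  ∎)
    }
    where open SetoidReasoning (≋-setoid r n)

open Matrices ℝ-commutativeRing public

data Sgn : Set where
  neg zer pos : Sgn

opp : Sgn → Sgn
opp neg = pos
opp zer = zer
opp pos = neg

infixl 7 _·_

_·_ : Sgn → Sgn → Sgn
neg · t = opp t
zer · t = zer
pos · t = t

NonNeg : Sgn → Set
NonNeg s = s ≢ neg

inversions : ∀ {r} → Permutation′ r → List (Fin r × Fin r)
inversions {r} σ =
  filter (λ (k , l) → (k <? l) ×-dec ((σ ⟨$⟩ʳ l) <? (σ ⟨$⟩ʳ k)))
         (cartesianProduct (allFin r) (allFin r))

sgn : ∀ {r} → Permutation′ r → Sgn
sgn σ = foldr (λ _ → opp) pos (inversions σ)

first : ∀ r .{{_ : NonZero r}} → Fin r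
first (suc r) = zero

record IsChirotope {r n : ℕ} .{{_ : NonZero r}} (χ : Vec (Fin n) r → Sgn) : Set where
  field
    nonzero     : ∃[ i ] χ i ≢ zer
    alternating : ∀ i (σ : Permutation′ r) →
                  χ (tabulate λ k → lookup i (σ ⟨$⟩ʳ k)) ≡ sgn σ · χ i
    exchange    : ∀ i j →
                  (∀ k → NonNeg (χ (i [ first r ]≔ lookup j k) ·
                                 χ (j [ k ]≔ lookup i (first r)))) →
                  NonNeg (χ i · χ j)

record OrientedMatroid (r n : ℕ) .{{_ : NonZero r}} : Set where
  field
    χ           : Vec (Fin n) r → Sgn
    isChirotope : IsChirotope χ

-- "sgn x = s", as a relation because the sign of a real is not computable.
HasSign : ℝ → Sgn → Set
HasSign x neg = x <ᴿ 0ᴿ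
HasSign x zer = x ≈ᴿ 0ᴿ
HasSign x pos = 0ᴿ <ᴿ x

-- "χ_X = χ"
HasChirotope : ∀ {r n} → Matrix r n → (Vec (Fin n) r → Sgn) → Set
HasChirotope X χ = ∀ i → HasSign (det (columns X i)) (χ i)

module _ {r n : ℕ} .{{_ : NonZero r}} (M : OrientedMatroid r n) where
  open OrientedMatroid M

  IsRealization : Pred (Matrix r n) 0ℓ
  IsRealization X =
    HasRank X r × (HasChirotope X χ ⊎ HasChirotope X (λ i → opp (χ i)))

record Subset (S : Setoid 0ℓ 0ℓ) : Set₁ where
  open Setoid S
  field
    mem  : Pred Carrier 0ℓ
    resp : mem Respects _≈_

open Subset public

-- A set together with the family of its open subsets.
record Space (ℓ : Level) : Set (lsuc 0ℓ ⊔ˡ lsuc ℓ) where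
  field
    points : Setoid 0ℓ 0ℓ
    Open   : Subset points → Set ℓ

-- Sup-norm distance less than ε.
Within : ∀ {m n} → ℝ → Rel (Matrix m n) 0ℓ
Within ε X Y = ∀ i j → (X i j +ᴿ -ᴿ Y i j <ᴿ ε) × (Y i j +ᴿ -ᴿ X i j <ᴿ ε)

matrixSpace : ℕ → ℕ → Space 0ℓ
matrixSpace m n = record
  { points = ≋-setoid m n
  ; Open   = λ U → ∀ X → mem U X →
      ∃[ ε ] (0ᴿ <ᴿ ε × (∀ Y → Within ε X Y → mem U Y))
  }

subspace : ∀ {ℓ} (T : Space ℓ) → Pred (Setoid.Carrier (Space.points T)) 0ℓ →
           Space (lsuc 0ℓ ⊔ˡ ℓ)
subspace T P = record
  { points = On.setoid {B = Σ Carrier P} points proj₁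
  ; Open   = λ U → ∃[ W ] (Open W × (∀ x → mem U x ⇔ mem W (proj₁ x)))
  }
  where
  open Space T
  open Setoid points using (Carrier)

-- The equivalence ∼ contains the equality of T, so a subset of the
-- quotient is a ∼-saturated subset of T, which serves as its own preimage.
quotient : ∀ {ℓ} (T : Space ℓ) (_∼_ : Rel (Setoid.Carrier (Space.points T)) 0ℓ) →
           IsEquivalence _∼_ → Setoid._≈_ (Space.points T) ⇒ _∼_ → Space ℓ
quotient T _∼_ ∼-equiv ≈⇒∼ = record
  { points = record { isEquivalence = ∼-equiv }
  ; Open   = λ U → Space.Open T (record
      { mem = mem U ; resp = λ x≈y → resp U (≈⇒∼ x≈y) })
  }

record Disconnected {ℓ} (T : Space ℓ) : Set (lsuc 0ℓ ⊔ˡ ℓ) where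
  open Space T
  open Setoid points using (Carrier)
  field
    U V        : Subset points
    U-open     : Open U
    V-open     : Open V
    U-nonempty : ∃[ x ] mem U x
    V-nonempty : ∃[ x ] mem V x
    disjoint   : ∀ x → ¬ (mem U x × mem V x)
    cover      : ∀ x → mem U x ⊎ mem V x

realizationSpace : ∀ {r n} .{{_ : NonZero r}} → OrientedMatroid r n → Space (lsuc 0ℓ)
realizationSpace {r} {n} M =
  quotient (subspace (matrixSpace r n) (IsRealization M))
    (λ X Y → LinearlyEquivalent (proj₁ X) (proj₁ Y))
    (On.isEquivalence proj₁ LinearlyEquivalent-isEquivalence)
    (λ {X} {Y} → ≋⇒LinearlyEquivalent {X = proj₁ X} {Y = proj₁ Y})

{-# OPTIONS --safe #-}

-- Let e₁, e₂, e₃, (1,1,1) be the points 0, 1, 2, 3 and put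
--   4 = (1,u,0), 5 = (0,1,1), 6 = (0,1-u,1), 7 = (1,1-u,1), 8 = (1,1,v),
--   9 = 45 ∩ 78, 10 = 02 ∩ 39, 11 = 08 ∩ 57.
-- Up to projective equivalence and scaling, every realization of the resulting
-- incidences on these twelve points has this form, and
--   det(4,10,11) = -u (1+u) (uv + (v-1)(v-2))   up to a nonzero factor.
-- Near u = -1, v = 2+√2 no other determinant of the generic configuration changes
-- sign, but both 1+u and uv + (v-1)(v-2) do.  Prescribing the sign of det(4,10,11)
-- therefore forces u ≠ -1 and leaves realizations on either side of u = -1.  The
-- sign of 1+u is read off from p (p + q), where 4 = (p,q,0); this is a polynomial
-- of degree four in the minors, so its sign is invariant under GL₃.
-- Point 12 = 02 ∩ 57 plays no role beyond raising the number of points to 13.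

module Submission where

open import Defs
open import Data.Fin.Base using (Fin; suc; _<_)
open import Data.Fin.Patterns
open import Data.Fin.Permutation using (Permutation′; _⟨$⟩ʳ_)
open import Data.Fin.Properties using (all?; _<?_)
open import Data.Integer.Base using (ℤ; +_; -_)
open import Data.List.Base using (allFin; cartesianProduct; filter; foldr)
open import Data.List.Properties using (filter-≐)
open import Data.Nat.Base as ℕ using (ℕ; nonZero; _⊔_)
import Data.Nat.Properties as ℕₚ
open import Data.Product.Base using (∃-syntax; Σ-syntax; _×_; _,_; proj₁; proj₂)
open import Data.Rational.Base as ℚ using (ℚ; 0ℚ; 1ℚ; ½; ∣_∣; 1/_; positive; nonNegative)
import Data.Rational.Properties as ℚₚ
open import Data.Rational.Solver using (module +-*-Solver)
open import Data.Sum.Base as Sum using (_⊎_; inj₁; inj₂)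
open import Data.Vec.Base using (Vec; []; _∷_; lookup; tabulate; _[_]≔_)
open import Function.Base using (_∘_; id)
open import Function.Bundles using (Injection; mk⇔)
open import Function.Properties.Inverse using (↔⇒↣)
open import Relation.Binary.Bundles using (Setoid)
open import Relation.Binary.Definitions using (DecidableEquality; tri<; tri≈; tri>)
open import Relation.Binary.PropositionalEquality as ≡ using (_≡_; _≢_)
import Relation.Binary.Reasoning.Setoid as SetoidReasoning
open import Relation.Binary.Structures using (IsEquivalence)
open import Relation.Nullary.Decidable using (Dec; yes; no; _×-dec_; from-yes)
open import Relation.Nullary.Negation.Core using (¬_; contradiction)
open +-*-Solver using (Polynomial; solve; con; _:=_; _:+_; _:*_; _:-_; :-_)

-- The sign of a real is undecidable here, so it is not enough that `p + q` never vanishes: `cover`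
-- must return the side on which a realization lies. This works because `HasSign` supplies a
-- rational gap for every nonzero determinant. If a product of reals is bounded away from zero, so
-- is each factor; the gap of det(4,10,11) therefore passes to its factor `p + q`, and a Cauchy
-- sequence bounded away from zero shows its sign in a single term. No coordinate is ever inverted:
-- the configuration stays homogeneous, vanishing minors become polynomial relations, and factors
-- bounded away from zero are cancelled. The curve uv + (v-1)(v-2) = 0 crosses the line u = -1
-- transversally at v = 2+√2, so the product of the two factors has equal signs in opposite sectors.
-- The points (-1/2, 7/2) and (-2, 4) lie in such sectors: the factors are 1/2 and 2 at the first,
-- -1 and -2 at the second. Both being rational, evaluation decides all their minors.

infixl 6 _-ᴿ_
_-ᴿ_ : ℝ → ℝ → ℝ
x -ᴿ y = x +ᴿ -ᴿ y

-- Estimates for rationals and for tails of sequences.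

0<½* : ∀ {ε} → 0ℚ ℚ.< ε → 0ℚ ℚ.< ½ ℚ.* ε
0<½* {ε} 0<ε = ℚₚ.positive⁻¹ _ {{ℚₚ.pos*pos⇒pos ½ ε {{positive 0<ε}}}}

0<* : ∀ {p q} → 0ℚ ℚ.< p → 0ℚ ℚ.< q → 0ℚ ℚ.< p ℚ.* q
0<* {p} {q} 0<p 0<q = ℚₚ.positive⁻¹ _ {{ℚₚ.pos*pos⇒pos p {{positive 0<p}} q {{positive 0<q}}}}

½*ε+½*ε : ∀ ε → ½ ℚ.* ε ℚ.+ ½ ℚ.* ε ≡ ε
½*ε+½*ε = solve 1 (λ ε → con ½ :* ε :+ con ½ :* ε := ε) ≡.refl

∃-divide : ∀ {ε B} → 0ℚ ℚ.< ε → 0ℚ ℚ.< B → ∃[ δ ] (0ℚ ℚ.< δ × B ℚ.* δ ≡ ε)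
∃-divide {ε} {B} 0<ε 0<B = (1/ B) ℚ.* ε , 0<* (ℚₚ.positive⁻¹ (1/ B) {{ℚₚ.1/pos⇒pos B}}) 0<ε ,
  ≡.trans (≡.sym (ℚₚ.*-assoc B (1/ B) ε))
    (≡.trans (≡.cong (ℚ._* ε) (ℚₚ.*-inverseʳ B)) (ℚₚ.*-identityˡ ε))
  where instance
    _ = positive 0<B
    _ = ℚₚ.pos⇒nonZero B

*-mono-<-≤ : ∀ {p q r s} → 0ℚ ℚ.≤ r → 0ℚ ℚ.< q → p ℚ.≤ q → r ℚ.< s → p ℚ.* r ℚ.< q ℚ.* s
*-mono-<-≤ {p} {q} {r} {s} 0≤r 0<q p≤q r<s = ℚₚ.≤-<-trans
  (ℚₚ.*-monoʳ-≤-nonNeg r {{nonNegative 0≤r}} p≤q)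
  (ℚₚ.*-monoʳ-<-pos q {{positive 0<q}} r<s)

∣p*q∣<* : ∀ {p q B C} → ∣ p ∣ ℚ.< B → ∣ q ∣ ℚ.< C → ∣ p ℚ.* q ∣ ℚ.< B ℚ.* C
∣p*q∣<* {p} {q} {B} p<B q<C = ≡.subst (ℚ._< _) (≡.sym (ℚₚ.∣p*q∣≡∣p∣*∣q∣ p q))
  (*-mono-<-≤ (ℚₚ.0≤∣p∣ q) (ℚₚ.≤-<-trans (ℚₚ.0≤∣p∣ p) p<B) (ℚₚ.<⇒≤ p<B) q<C)

∣p∣≤∣q∣+∣q-p∣ : ∀ p q → ∣ p ∣ ℚ.≤ ∣ q ∣ ℚ.+ ∣ q ℚ.- p ∣
∣p∣≤∣q∣+∣q-p∣ p q = ≡.subst (λ r → ∣ r ∣ ℚ.≤ ∣ q ∣ ℚ.+ ∣ q ℚ.- p ∣)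
  (solve 2 (λ p q → q :- (q :- p) := p) ≡.refl p q) (ℚₚ.∣p-q∣≤∣p∣+∣q∣ q (q ℚ.- p))

p≤∣p∣ : ∀ p → p ℚ.≤ ∣ p ∣
p≤∣p∣ p with ℚₚ.≤-total 0ℚ p
... | inj₁ 0≤p = ℚₚ.≤-reflexive (≡.sym (ℚₚ.0≤p⇒∣p∣≡p 0≤p))
... | inj₂ p≤0 = ℚₚ.≤-trans p≤0 (ℚₚ.0≤∣p∣ p)

∣p∣<q : ∀ {p q} → p ℚ.< q → ℚ.- p ℚ.< q → ∣ p ∣ ℚ.< q
∣p∣<q {p} p<q -p<q with ℚₚ.∣p∣≡p∨∣p∣≡-p p
... | inj₁ ∣p∣≡p  = ≡.subst (ℚ._< _) (≡.sym ∣p∣≡p) p<q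
... | inj₂ ∣p∣≡-p = ≡.subst (ℚ._< _) (≡.sym ∣p∣≡-p) -p<q

∣p∣<q⇒p<q : ∀ {p q} → ∣ p ∣ ℚ.< q → p ℚ.< q
∣p∣<q⇒p<q {p} = ℚₚ.≤-<-trans (p≤∣p∣ p)

both : ∀ {P Q R : ℕ → Set} → (∀ {n} → P n → Q n → R n) →
       Eventually P → Eventually Q → Eventually R
both f (M , p) (N , q) = M ⊔ N , λ n M⊔N≤n →
  f (p n (ℕₚ.≤-trans (ℕₚ.m≤m⊔n M N) M⊔N≤n)) (q n (ℕₚ.≤-trans (ℕₚ.m≤n⊔m M N) M⊔N≤n))

each : ∀ {P Q : ℕ → Set} → (∀ {n} → P n → Q n) → Eventually P → Eventually Q
each f (N , p) = N , λ n N≤n → f (p n N≤n)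

bounded : ∀ x → ∃[ B ] (0ℚ ℚ.< B × Eventually λ n → ∣ seq x n ∣ ℚ.< B)
bounded x with cauchy x 1ℚ (ℚₚ.positive⁻¹ 1ℚ)
... | N , close = ∣ seq x N ∣ ℚ.+ 1ℚ , ℚₚ.+-mono-≤-< (ℚₚ.0≤∣p∣ (seq x N)) (ℚₚ.positive⁻¹ 1ℚ) , N ,
  λ n N≤n → ℚₚ.≤-<-trans (∣p∣≤∣q∣+∣q-p∣ (seq x n) (seq x N))
    (ℚₚ.+-monoʳ-< ∣ seq x N ∣ (close N n ℕₚ.≤-refl N≤n))

-- Equality, positivity and apartness of reals.

infix 4 _≃_

-- Unlike the function _≈ᴿ_, the record determines its indices under unification.
record _≃_ (x y : ℝ) : Set where
  constructor ⟪_⟫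
  field close : x ≈ᴿ y
open _≃_

infix 4 0<_ _#0

record 0<_ (x : ℝ) : Set where
  constructor exceeds
  field
    {gap} : ℚ
    gap>0 : 0ℚ ℚ.< gap
    above : Eventually λ n → gap ℚ.< seq x n

-- The gap bounds absolute values and does not name a side; a side is found only with the help of
-- the Cauchy condition, in `#0⇒0<`.
record _#0 (x : ℝ) : Set where
  constructor apart
  field
    {gap} : ℚ
    gap>0 : 0ℚ ℚ.< gap
    away  : Eventually λ n → gap ℚ.< ∣ seq x n ∣

pointwise : ∀ {x y} → (∀ n → seq x n ≡ seq y n) → x ≃ y
pointwise {x} {y} eq = ⟪ pointwise⇒≈ᴿ x y eq ⟫

≃-setoid : Setoid _ _
≃-setoid = record
  { _≈_ = _≃_
  ; isEquivalence = record
    { refl  = pointwise λ _ → ≡.refl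
    ; sym   = λ {x} {y} (⟪ p ⟫) → ⟪ IsEquivalence.sym ≈ᴿ-isEquivalence {x} {y} p ⟫
    ; trans = λ {x} {y} {z} (⟪ p ⟫) (⟪ q ⟫) → ⟪ IsEquivalence.trans ≈ᴿ-isEquivalence {x} {y} {z} p q ⟫
    }
  }

open Setoid ≃-setoid public using () renaming (refl to ≃-refl; sym to ≃-sym; trans to ≃-trans)

+-cong : ∀ {x y u v} → x ≃ y → u ≃ v → x +ᴿ u ≃ y +ᴿ v
+-cong {x} {y} {u} {v} (⟪ p ⟫) (⟪ q ⟫) = ⟪ +ᴿ-cong {x} {y} {u} {v} p q ⟫

*-cong : ∀ {x y u v} → x ≃ y → u ≃ v → x *ᴿ u ≃ y *ᴿ v
*-cong {x} {y} {u} {v} (⟪ p ⟫) (⟪ q ⟫) = ⟪ *ᴿ-cong {x} {y} {u} {v} p q ⟫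

neg-cong : ∀ {x y} → x ≃ y → -ᴿ x ≃ -ᴿ y
neg-cong {x} {y} (⟪ p ⟫) = ⟪ -ᴿ-cong {x} {y} p ⟫

0<⇒0<ᴿ : ∀ {x} → 0< x → 0ᴿ <ᴿ x
0<⇒0<ᴿ (exceeds {ε} 0<ε above) = ε , 0<ε , each (≡.subst (ℚ._< _) (≡.sym (ℚₚ.+-identityˡ ε))) above

0<ᴿ⇒0< : ∀ {x} → 0ᴿ <ᴿ x → 0< x
0<ᴿ⇒0< (ε , 0<ε , above) = exceeds 0<ε (each (≡.subst (ℚ._< _) (ℚₚ.+-identityˡ ε)) above)

0<-neg⇒<ᴿ0 : ∀ {x} → 0< -ᴿ x → x <ᴿ 0ᴿ
0<-neg⇒<ᴿ0 {x} (exceeds {ε} 0<ε above) = ε , 0<ε , each (λ {n} → below n) above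
  where
  below : ∀ n → ε ℚ.< ℚ.- seq x n → seq x n ℚ.+ ε ℚ.< 0ℚ
  below n ε<-x = ≡.subst (seq x n ℚ.+ ε ℚ.<_) (ℚₚ.+-inverseʳ (seq x n)) (ℚₚ.+-monoʳ-< (seq x n) ε<-x)

<ᴿ0⇒0<-neg : ∀ {x} → x <ᴿ 0ᴿ → 0< -ᴿ x
<ᴿ0⇒0<-neg {x} (ε , 0<ε , below) = exceeds 0<ε (each (λ {n} → above n) below)
  where
  above : ∀ n → seq x n ℚ.+ ε ℚ.< 0ℚ → ε ℚ.< ℚ.- seq x n
  above n x+ε<0 = ≡.subst₂ ℚ._<_
    (solve 2 (λ x ε → :- x :+ (x :+ ε) := ε) ≡.refl (seq x n) ε) (ℚₚ.+-identityʳ (ℚ.- seq x n))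
    (ℚₚ.+-monoʳ-< (ℚ.- seq x n) x+ε<0)

0<-fromℚ : ∀ {q} → 0ℚ ℚ.< q → 0< fromℚ q
-- Half of `q` is taken because the gap must lie strictly below the constant term.
0<-fromℚ {q} 0<q = exceeds (0<½* 0<q) (0 , λ _ _ → ½q<q)
  where
  ½q<q : ½ ℚ.* q ℚ.< q
  ½q<q = ≡.subst₂ ℚ._<_ (ℚₚ.+-identityʳ (½ ℚ.* q)) (½*ε+½*ε q) (ℚₚ.+-monoʳ-< (½ ℚ.* q) (0<½* 0<q))

0<⇒#0 : ∀ {x} → 0< x → x #0
0<⇒#0 {x} (exceeds 0<ε above) = apart 0<ε (each (λ {n} ε<x → ℚₚ.<-≤-trans ε<x (p≤∣p∣ (seq x n))) above)

0<-neg⇒#0 : ∀ {x} → 0< -ᴿ x → x #0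
0<-neg⇒#0 {x} (exceeds 0<ε above) = apart 0<ε (each (λ {n} ε<-x →
  ≡.subst (_ ℚ.<_) (ℚₚ.∣-p∣≡∣p∣ (seq x n)) (ℚₚ.<-≤-trans ε<-x (p≤∣p∣ (ℚ.- seq x n)))) above)

+-cancelʳ-< : ∀ {p q} r → p ℚ.+ r ℚ.< q ℚ.+ r → p ℚ.< q
+-cancelʳ-< {p} {q} r p+r<q+r = ≡.subst₂ ℚ._<_ (cancel p) (cancel q) (ℚₚ.+-monoˡ-< (ℚ.- r) p+r<q+r)
  where
  cancel : ∀ p → p ℚ.+ r ℚ.- r ≡ p
  cancel p = solve 2 (λ p r → p :+ r :- r := p) ≡.refl p r

½*ε<-near : ∀ {ε p q r} → ε ℚ.< q → q ℚ.≤ p ℚ.+ r → r ℚ.< ½ ℚ.* ε → ½ ℚ.* ε ℚ.< p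
½*ε<-near {ε} {p} {q} {r} ε<q q≤p+r r<½ε = +-cancelʳ-< {½ ℚ.* ε} {p} (½ ℚ.* ε) (begin-strict
  ½ ℚ.* ε ℚ.+ ½ ℚ.* ε ≡⟨ ½*ε+½*ε ε ⟩
  ε                   <⟨ ε<q ⟩
  q                   ≤⟨ q≤p+r ⟩
  p ℚ.+ r             <⟨ ℚₚ.+-monoʳ-< p r<½ε ⟩
  p ℚ.+ ½ ℚ.* ε       ∎)
  where open ℚₚ.≤-Reasoning

q≤p+∣q-p∣ : ∀ p q → q ℚ.≤ p ℚ.+ ∣ q ℚ.- p ∣
q≤p+∣q-p∣ p q = ≡.subst (ℚ._≤ p ℚ.+ ∣ q ℚ.- p ∣) (solve 2 (λ p q → p :+ (q :- p) := q) ≡.refl p q)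
  (ℚₚ.+-monoʳ-≤ p (p≤∣p∣ (q ℚ.- p)))

∣p-q∣≡∣q-p∣ : ∀ p q → ∣ p ℚ.- q ∣ ≡ ∣ q ℚ.- p ∣
∣p-q∣≡∣q-p∣ p q = ≡.trans (≡.sym (ℚₚ.∣-p∣≡∣p∣ (p ℚ.- q)))
  (≡.cong ∣_∣ (solve 2 (λ p q → :- (p :- q) := q :- p) ≡.refl p q))

-- Half of the gap survives a perturbation smaller than the other half. Closeness at this one
-- tolerance is enough, so the lemma serves equal reals (`0<-cong`) as well as values at nearby
-- matrices (`0<-open`).
0<-near : ∀ {x y} (0<x : 0< x) →
          Eventually (λ n → ∣ seq x n ℚ.- seq y n ∣ ℚ.< ½ ℚ.* 0<_.gap 0<x) → 0< y
0<-near {x} {y} (exceeds 0<ε above) near = exceeds (0<½* 0<ε)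
  (both (λ {n} ε<x → ½*ε<-near ε<x (q≤p+∣q-p∣ (seq y n) (seq x n))) above near)

0<-cong : ∀ {x y} → x ≃ y → 0< x → 0< y
0<-cong x≃y 0<x = 0<-near 0<x (close x≃y _ (0<½* (0<_.gap>0 0<x)))

#0-cong : ∀ {x y} → x ≃ y → x #0 → y #0
#0-cong {x} {y} x≃y (apart 0<ε away) = apart (0<½* 0<ε)
  (both (λ {n} ε<x near → ½*ε<-near ε<x (∣p∣≤∣q∣+∣q-p∣ (seq x n) (seq y n))
           (≡.subst (ℚ._< _) (∣p-q∣≡∣q-p∣ (seq x n) (seq y n)) near))
        away (close x≃y _ (0<½* 0<ε)))

-- Beyond the Cauchy modulus for half the gap the terms cannot change sign, so the sign of the
-- rational term at `K` decides. The covering of the realization space by two open sets rests on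
-- this decision.
#0⇒0< : ∀ {x} → x #0 → 0< x ⊎ 0< -ᴿ x
#0⇒0< {x} (apart {ε} 0<ε (M , away)) with cauchy x (½ ℚ.* ε) (0<½* 0<ε)
... | N , close = Sum.map
    (λ ε<x → exceeds (0<½* 0<ε) (N , λ n N≤n →
      ½*ε<-near ε<x (q≤p+∣q-p∣ (seq x n) (seq x K)) (close K n N≤K N≤n)))
    (λ ε<-x → exceeds (0<½* 0<ε) (N , λ n N≤n →
      ½*ε<-near ε<-x (q≤p+∣q-p∣ (ℚ.- seq x n) (ℚ.- seq x K))
        (≡.subst (ℚ._< _) (∣-p--q∣ (seq x n) (seq x K)) (close n K N≤n N≤K))))
    (split (away K (ℕₚ.m≤m⊔n M N)))
  where
  K = M ⊔ N
  N≤K = ℕₚ.m≤n⊔m M N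
  split : ε ℚ.< ∣ seq x K ∣ → ε ℚ.< seq x K ⊎ ε ℚ.< ℚ.- seq x K
  split with ℚₚ.∣p∣≡p∨∣p∣≡-p (seq x K)
  ... | inj₁ ∣x∣≡x  = inj₁ ∘ ≡.subst (ε ℚ.<_) ∣x∣≡x
  ... | inj₂ ∣x∣≡-x = inj₂ ∘ ≡.subst (ε ℚ.<_) ∣x∣≡-x
  ∣-p--q∣ : ∀ p q → ∣ p ℚ.- q ∣ ≡ ∣ ℚ.- q ℚ.- ℚ.- p ∣
  ∣-p--q∣ p q = ≡.cong ∣_∣ (solve 2 (λ p q → p :- q := :- q :- :- p) ≡.refl p q)

¬0<∧0<-neg : ∀ {x} → 0< x → ¬ 0< -ᴿ x
¬0<∧0<-neg {x} (exceeds 0<ε (M , above)) (exceeds 0<δ (N , below)) = ℚₚ.<-irrefl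
  (≡.sym (ℚₚ.+-inverseʳ (seq x K)))
  (ℚₚ.+-mono-< (ℚₚ.<-trans 0<ε (above K (ℕₚ.m≤m⊔n M N))) (ℚₚ.<-trans 0<δ (below K (ℕₚ.m≤n⊔m M N))))
  where K = M ⊔ N

*-mono-<-pos : ∀ {p q r s} → 0ℚ ℚ.< p → 0ℚ ℚ.< r → p ℚ.< q → r ℚ.< s → p ℚ.* r ℚ.< q ℚ.* s
*-mono-<-pos 0<p 0<r p<q r<s =
  *-mono-<-≤ (ℚₚ.<⇒≤ 0<r) (ℚₚ.<-trans 0<p p<q) (ℚₚ.<⇒≤ p<q) r<s

0<-* : ∀ {x y} → 0< x → 0< y → 0< x *ᴿ y
0<-* (exceeds 0<ε ε<x) (exceeds 0<δ δ<y) = exceeds (0<* 0<ε 0<δ) (both (*-mono-<-pos 0<ε 0<δ) ε<x δ<y)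

#0-* : ∀ {x y} → x #0 → y #0 → x *ᴿ y #0
#0-* {x} {y} (apart 0<ε ε<x) (apart 0<δ δ<y) = apart (0<* 0<ε 0<δ)
  (both (λ {n} ε<x δ<y → ≡.subst (_ ℚ.<_) (≡.sym (ℚₚ.∣p*q∣≡∣p∣*∣q∣ (seq x n) (seq y n)))
           (*-mono-<-pos 0<ε 0<δ ε<x δ<y)) ε<x δ<y)

∣∣-divide : ∀ {p q B δ} → 0ℚ ℚ.< B → B ℚ.* δ ℚ.< ∣ p ℚ.* q ∣ → ∣ q ∣ ℚ.< B → δ ℚ.< ∣ p ∣
∣∣-divide {p} {q} {B} {δ} 0<B Bδ<pq q<B =
  ℚₚ.*-cancelˡ-<-nonNeg B {{nonNegative (ℚₚ.<⇒≤ 0<B)}} {δ} {∣ p ∣} (begin-strict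
  B ℚ.* δ         <⟨ Bδ<pq ⟩
  ∣ p ℚ.* q ∣     ≡⟨ ℚₚ.∣p*q∣≡∣p∣*∣q∣ p q ⟩
  ∣ p ∣ ℚ.* ∣ q ∣ ≤⟨ ℚₚ.*-monoˡ-≤-nonNeg ∣ p ∣ {{ℚₚ.∣-∣-nonNeg p}} (ℚₚ.<⇒≤ q<B) ⟩
  ∣ p ∣ ℚ.* B     ≡⟨ ℚₚ.*-comm ∣ p ∣ B ⟩
  B ℚ.* ∣ p ∣     ∎)
  where open ℚₚ.≤-Reasoning

∣∣-cancel : ∀ {p q ε η} → 0ℚ ℚ.< ε → ε ℚ.< ∣ p ∣ → ∣ p ℚ.* q ∣ ℚ.< ε ℚ.* η → ∣ q ∣ ℚ.< η
∣∣-cancel {p} {q} {ε} {η} 0<ε ε<p pq<εη =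
  ℚₚ.*-cancelˡ-<-nonNeg ε {{nonNegative (ℚₚ.<⇒≤ 0<ε)}} {∣ q ∣} {η} (begin-strict
  ε ℚ.* ∣ q ∣     ≤⟨ ℚₚ.*-monoʳ-≤-nonNeg ∣ q ∣ {{ℚₚ.∣-∣-nonNeg q}} (ℚₚ.<⇒≤ ε<p) ⟩
  ∣ p ∣ ℚ.* ∣ q ∣ ≡⟨ ℚₚ.∣p*q∣≡∣p∣*∣q∣ p q ⟨
  ∣ p ℚ.* q ∣     <⟨ pq<εη ⟩
  ε ℚ.* η         ∎)
  where open ℚₚ.≤-Reasoning

-- The sequence of `y` is eventually bounded by some `B`, so a gap `ε` of the product leaves the gap
-- `ε / B` for `x`.
#0-*⁻ˡ : ∀ {x y} → x *ᴿ y #0 → x #0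
#0-*⁻ˡ {x} {y} (apart {ε} 0<ε away) =
  let B , 0<B , y<B = bounded y
      δ , 0<δ , Bδ≡ε = ∃-divide 0<ε 0<B
  in apart 0<δ (both (λ {n} ε<xy → ∣∣-divide {seq x n} {seq y n} {B} {δ} 0<B
       (≡.subst (ℚ._< ∣ seq x n ℚ.* seq y n ∣) (≡.sym Bδ≡ε) ε<xy)) away y<B)

#0-*⁻ʳ : ∀ {x y} → x *ᴿ y #0 → y #0
#0-*⁻ʳ {x} {y} xy#0 = #0-*⁻ˡ {y} {x} (#0-cong (pointwise λ n → ℚₚ.*-comm (seq x n) (seq y n)) xy#0)

-- Cancellation without an inverse: where the absolute value of `x` exceeds its gap `ε`, the bound
-- `ε η` on the product forces that of `y` below `η`.
*-cancelˡ-#0 : ∀ {x y} → x #0 → x *ᴿ y ≃ 0ᴿ → y ≃ 0ᴿ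
*-cancelˡ-#0 {x} {y} (apart {ε} 0<ε away) xy≃0 = ⟪ (λ η 0<η →
  both (λ {n} ε<x xy<εη → ≡.subst (λ y → ∣ y ∣ ℚ.< η) (≡.sym (ℚₚ.+-identityʳ (seq y n)))
      (∣∣-cancel {seq x n} {seq y n} {ε} {η} 0<ε ε<x
        (≡.subst (λ xy → ∣ xy ∣ ℚ.< ε ℚ.* η) (ℚₚ.+-identityʳ (seq x n ℚ.* seq y n)) xy<εη)))
    away (close xy≃0 (ε ℚ.* η) (0<* 0<ε 0<η))) ⟫

square-neg : ∀ x → -ᴿ x *ᴿ -ᴿ x ≃ x *ᴿ x
square-neg x = pointwise λ n → solve 1 (λ x → :- x :* :- x := x :* x) ≡.refl (seq x n)

0<-square : ∀ {x} → x #0 → 0< x *ᴿ x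
0<-square {x} x#0 = Sum.[ (λ 0<x → 0<-* {x} {x} 0<x 0<x)
  , (λ 0<-x → 0<-cong (square-neg x) (0<-* { -ᴿ x} { -ᴿ x} 0<-x 0<-x)) ] (#0⇒0< x#0)

-- Continuity of polynomial functions of a matrix.

Nearby : ∀ {m n} → Matrix m n → (Matrix m n → Set) → Set
Nearby X P = ∃[ δ ] (0ℚ ℚ.< δ × ∀ Y → Within (fromℚ δ) X Y → P Y)

Within-mono : ∀ {m n δ ε} {X Y : Matrix m n} → δ ℚ.≤ ε → Within (fromℚ δ) X Y → Within (fromℚ ε) X Y
Within-mono {X = X} {Y} δ≤ε near i j with near i j
... | (γ , 0<γ , X-Y<δ) , (γ′ , 0<γ′ , Y-X<δ) =
  (γ , 0<γ , each (λ lt → ℚₚ.<-≤-trans lt δ≤ε) X-Y<δ) ,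
  (γ′ , 0<γ′ , each (λ lt → ℚₚ.<-≤-trans lt δ≤ε) Y-X<δ)

Nearby-× : ∀ {m n} {X : Matrix m n} {P Q} → Nearby X P → Nearby X Q → Nearby X (λ Y → P Y × Q Y)
Nearby-× {X = X} (δ , 0<δ , p) (ε , 0<ε , q) = δ ℚ.⊓ ε , 0<⊓ , λ Y near →
  p Y (Within-mono {X = X} {Y} (ℚₚ.p⊓q≤p δ ε) near) ,
  q Y (Within-mono {X = X} {Y} (ℚₚ.p⊓q≤q δ ε) near)
  where
  0<⊓ : 0ℚ ℚ.< δ ℚ.⊓ ε
  0<⊓ with ℚₚ.⊓-sel δ ε
  ... | inj₁ e = ≡.subst (0ℚ ℚ.<_) (≡.sym e) 0<δ
  ... | inj₂ e = ≡.subst (0ℚ ℚ.<_) (≡.sym e) 0<ε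

Nearby-map : ∀ {m n} {X : Matrix m n} {P Q : Matrix m n → Set} →
             (∀ {Y} → P Y → Q Y) → Nearby X P → Nearby X Q
Nearby-map f (δ , 0<δ , p) = δ , 0<δ , λ Y near → f (p Y near)

-- Closeness is expressed on the terms of the sequences, the form in which `0<-near` consumes it.
-- Radii are rational so that `Nearby-×` can tell which of two is smaller.
Continuous : ∀ {m n} → (Matrix m n → ℝ) → Set
Continuous f = ∀ X ε → 0ℚ ℚ.< ε →
  Nearby X λ Y → Eventually λ n → ∣ seq (f X) n ℚ.- seq (f Y) n ∣ ℚ.< ε

∣∣<-½+½ : ∀ {ε p q} → ∣ p ∣ ℚ.< ½ ℚ.* ε → ∣ q ∣ ℚ.< ½ ℚ.* ε → ∣ p ℚ.+ q ∣ ℚ.< ε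
∣∣<-½+½ {ε} {p} {q} a b = ℚₚ.≤-<-trans (ℚₚ.∣p+q∣≤∣p∣+∣q∣ p q)
  (≡.subst (_ ℚ.<_) (½*ε+½*ε ε) (ℚₚ.+-mono-< a b))

record ContinuousMap (m n : ℕ) : Set where
  field
    fun        : Matrix m n → ℝ
    continuous : Continuous fun
open ContinuousMap

entry : ∀ {m n} → Fin m → Fin n → ContinuousMap m n
fun        (entry i j) X = X i j
continuous (entry i j) X ε 0<ε = ε , 0<ε , λ Y near → within (X i j) (Y i j) (near i j)
  where
  drop : ∀ {p γ} → 0ℚ ℚ.< γ → p ℚ.+ γ ℚ.< ε → p ℚ.< ε
  drop {p} {γ} 0<γ = ℚₚ.<-trans (≡.subst (ℚ._< p ℚ.+ γ) (ℚₚ.+-identityʳ p) (ℚₚ.+-monoʳ-< p 0<γ))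
  within : ∀ x y → (x +ᴿ -ᴿ y <ᴿ fromℚ ε) × (y +ᴿ -ᴿ x <ᴿ fromℚ ε) →
           Eventually λ n → ∣ seq x n ℚ.- seq y n ∣ ℚ.< ε
  within x y ((γ , 0<γ , x-y) , (γ′ , 0<γ′ , y-x)) = both (λ {n} x-y y-x →
    ∣p∣<q (drop {seq x n ℚ.- seq y n} 0<γ x-y) (≡.subst (ℚ._< ε)
      (solve 2 (λ x y → y :- x := :- (x :- y)) ≡.refl (seq x n) (seq y n))
      (drop {seq y n ℚ.- seq x n} 0<γ′ y-x))) x-y y-x

infixl 6 _⊕_
infixl 7 _⊗_
infix  8 ⊖_

_⊕_ _⊗_ : ∀ {m n} → ContinuousMap m n → ContinuousMap m n → ContinuousMap m n
⊖_ : ∀ {m n} → ContinuousMap m n → ContinuousMap m n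

fun        (f ⊕ g) X = fun f X +ᴿ fun g X
continuous (f ⊕ g) X ε 0<ε =
  Nearby-map {X = X} (λ {Y} (near-f , near-g) → both (λ {n} →
      close-+ (seq (fun f X) n) (seq (fun g X) n) (seq (fun f Y) n) (seq (fun g Y) n)) near-f near-g)
    (Nearby-× {X = X} (continuous f X (½ ℚ.* ε) (0<½* 0<ε)) (continuous g X (½ ℚ.* ε) (0<½* 0<ε)))
  where
  close-+ : ∀ a b c d → ∣ a ℚ.- c ∣ ℚ.< ½ ℚ.* ε → ∣ b ℚ.- d ∣ ℚ.< ½ ℚ.* ε →
            ∣ a ℚ.+ b ℚ.- (c ℚ.+ d) ∣ ℚ.< ε
  close-+ a b c d a-c b-d = ≡.subst (λ e → ∣ e ∣ ℚ.< ε)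
    (solve 4 (λ a b c d → (a :- c) :+ (b :- d) := (a :+ b) :- (c :+ d)) ≡.refl a b c d)
    (∣∣<-½+½ {ε} {a ℚ.- c} {b ℚ.- d} a-c b-d)

fun        (⊖ f) X = -ᴿ fun f X
continuous (⊖ f) X ε 0<ε =
  Nearby-map {X = X} (λ {Y} → each (λ {n} → ≡.subst (ℚ._< ε) (∣-∣-neg (seq (fun f X) n) (seq (fun f Y) n))))
    (continuous f X ε 0<ε)
  where
  ∣-∣-neg : ∀ p q → ∣ p ℚ.- q ∣ ≡ ∣ ℚ.- p ℚ.- ℚ.- q ∣
  ∣-∣-neg p q = ≡.trans (∣p-q∣≡∣q-p∣ p q)
    (≡.cong ∣_∣ (solve 2 (λ p q → q :- p := :- p :- :- q) ≡.refl p q))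

fun        (f ⊗ g) X = fun f X *ᴿ fun g X
continuous (f ⊗ g) X ε 0<ε =
  let A , 0<A , f<A = bounded (fun f X)
      B , 0<B , g<B = bounded (fun g X)
      -- `B` bounds `g` at `X` only; asking also for closeness 1 makes `B + 1` a bound for `g` at
      -- `Y`.
      0<B+1 = ℚₚ.+-mono-< 0<B (ℚₚ.positive⁻¹ 1ℚ)
      α , 0<α , Aα≡½ε = ∃-divide (0<½* 0<ε) 0<A
      β , 0<β , [B+1]β≡½ε = ∃-divide {B = B ℚ.+ 1ℚ} (0<½* 0<ε) 0<B+1
  in Nearby-map {X = X}
      (λ {Y} (g-1 , g-α , f-β) → both
        (λ {n} (f<A , g<B) (g-1 , g-α , f-β) →
          close-* A B α β Aα≡½ε [B+1]β≡½ε (seq (fun f X) n) (seq (fun g X) n) (seq (fun f Y) n) (seq (fun g Y) n)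
            f<A g<B g-1 g-α f-β)
        (both _,_ f<A g<B) (both _,_ g-1 (both _,_ g-α f-β)))
      (Nearby-× {X = X} (continuous g X 1ℚ (ℚₚ.positive⁻¹ 1ℚ))
        (Nearby-× {X = X} (continuous g X α 0<α) (continuous f X β 0<β)))
  where
  close-* : ∀ A B α β → A ℚ.* α ≡ ½ ℚ.* ε → (B ℚ.+ 1ℚ) ℚ.* β ≡ ½ ℚ.* ε →
            ∀ a b c d → ∣ a ∣ ℚ.< A → ∣ b ∣ ℚ.< B → ∣ b ℚ.- d ∣ ℚ.< 1ℚ →
            ∣ b ℚ.- d ∣ ℚ.< α → ∣ a ℚ.- c ∣ ℚ.< β → ∣ a ℚ.* b ℚ.- c ℚ.* d ∣ ℚ.< ε
  close-* A B α β Aα≡½ε [B+1]β≡½ε a b c d a<A b<B b-d<1 b-d<α a-c<β = ≡.subst (λ e → ∣ e ∣ ℚ.< ε)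
    (solve 4 (λ a b c d → a :* (b :- d) :+ d :* (a :- c) := a :* b :- c :* d) ≡.refl a b c d)
    (∣∣<-½+½ {ε} {a ℚ.* (b ℚ.- d)} {d ℚ.* (a ℚ.- c)}
      (≡.subst (∣ a ℚ.* (b ℚ.- d) ∣ ℚ.<_) Aα≡½ε (∣p*q∣<* {a} {b ℚ.- d} {A} {α} a<A b-d<α))
      (≡.subst (∣ d ℚ.* (a ℚ.- c) ∣ ℚ.<_) [B+1]β≡½ε (∣p*q∣<* {d} {a ℚ.- c} {B ℚ.+ 1ℚ} {β} d<B+1 a-c<β)))
    where
    d<B+1 : ∣ d ∣ ℚ.< B ℚ.+ 1ℚ
    d<B+1 = ℚₚ.≤-<-trans (∣p∣≤∣q∣+∣q-p∣ d b) (ℚₚ.+-mono-< b<B b-d<1)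

0<-open : ∀ {m n} (f : ContinuousMap m n) X → 0< fun f X →
          ∃[ ε ] (0ᴿ <ᴿ ε × (∀ Y → Within ε X Y → 0< fun f Y))
0<-open f X 0<fX with continuous f X (½ ℚ.* 0<_.gap 0<fX) (0<½* (0<_.gap>0 0<fX))
... | δ , 0<δ , near = fromℚ δ , 0<⇒0<ᴿ {fromℚ δ} (0<-fromℚ 0<δ) ,
  λ Y XY → 0<-near {fun f X} {fun f Y} 0<fX (near Y XY)

≋⇒Within : ∀ {m n} {X Y : Matrix m n} {δ} → 0ℚ ℚ.< δ → X ≋ Y → Within (fromℚ δ) X Y
≋⇒Within {X = X} {Y} {δ} 0<δ X≋Y i j =
  below (X i j) (Y i j) (X≋Y i j) , below (Y i j) (X i j) (close (≃-sym (⟪_⟫ {X i j} {Y i j} (X≋Y i j))))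
  where
  below : ∀ x y → x ≈ᴿ y → x +ᴿ -ᴿ y <ᴿ fromℚ δ
  below x y x≈y = ½ ℚ.* δ , 0<½* 0<δ , each (λ {n} x-y<½δ →
    ≡.subst (seq x n ℚ.- seq y n ℚ.+ ½ ℚ.* δ ℚ.<_) (½*ε+½*ε δ)
    (ℚₚ.+-monoˡ-< (½ ℚ.* δ) (∣p∣<q⇒p<q {seq x n ℚ.- seq y n} x-y<½δ))) (x≈y (½ ℚ.* δ) (0<½* 0<δ))

-- Equal matrices lie within every distance of each other, so congruence is a consequence of
-- continuity.
fun-cong : ∀ {m n} (f : ContinuousMap m n) {X Y} → X ≋ Y → fun f X ≃ fun f Y
fun-cong f {X} {Y} X≋Y = ⟪ (λ ε 0<ε →
  let δ , 0<δ , near = continuous f X ε 0<ε in near Y (≋⇒Within {X = X} {Y} 0<δ X≋Y)) ⟫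

-- Determinants of order three and the action of matrices on them.

Vector : Set → Set
Vector A = Fin 3 → A

vec : ∀ {A} → A → A → A → Vector A
vec x y z 0F = x
vec x y z 1F = y
vec x y z 2F = z

-- Opaque, since conversion checking would otherwise η-expand rationals and reals.
opaque
  volume : (u v w : Vector ℚ) → ℚ
  volume u v w = u 0F ℚ.* (v 1F ℚ.* w 2F ℚ.- v 2F ℚ.* w 1F)
          ℚ.- u 1F ℚ.* (v 0F ℚ.* w 2F ℚ.- v 2F ℚ.* w 0F)
          ℚ.+ u 2F ℚ.* (v 0F ℚ.* w 1F ℚ.- v 1F ℚ.* w 0F)

:volume : ∀ {n} (u v w : Vector (Polynomial n)) → Polynomial n
:volume u v w = u 0F :* (v 1F :* w 2F :- v 2F :* w 1F)
          :- u 1F :* (v 0F :* w 2F :- v 2F :* w 0F)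
          :+ u 2F :* (v 0F :* w 1F :- v 1F :* w 0F)

at : ℕ → Vector ℝ → Vector ℚ
at n u i = seq (u i) n

opaque
  [_,_,_] : (u v w : Vector ℝ) → ℝ
  [ u , v , w ] = u 0F *ᴿ (v 1F *ᴿ w 2F -ᴿ v 2F *ᴿ w 1F)
               -ᴿ u 1F *ᴿ (v 0F *ᴿ w 2F -ᴿ v 2F *ᴿ w 0F)
               +ᴿ u 2F *ᴿ (v 0F *ᴿ w 1F -ᴿ v 1F *ᴿ w 0F)

opaque
  unfolding volume [_,_,_]

  -- Real arithmetic is termwise. Determinant identities are therefore proved for rational vectors
  -- by the ring solver and carried to the reals one index at a time.
  seq-volume : ∀ u v w n → seq [ u , v , w ] n ≡ volume (at n u) (at n v) (at n w)
  seq-volume u v w n = ≡.refl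

opaque
  -- An opaque name for `det` on selected columns, which keeps the Laplace expansion folded while
  -- signs are compared.
  maximalMinor : ∀ {r n} → Matrix r n → Vec (Fin n) r → ℝ
  maximalMinor X s = det (columns X s)

  HasChirotope⇒HasSign : ∀ {r n} (X : Matrix r n) χ → HasChirotope X χ →
    ∀ s → HasSign (maximalMinor X s) (χ s)
  HasChirotope⇒HasSign X χ X-χ s = X-χ s

  HasSign⇒HasChirotope : ∀ {r n} (X : Matrix r n) χ →
    (∀ s → HasSign (maximalMinor X s) (χ s)) → HasChirotope X χ
  HasSign⇒HasChirotope X χ X-χ s = X-χ s

column : ∀ {n} → Matrix 3 n → Fin n → Vector ℝ
column X j i = X i j

opaque
  unfolding maximalMinor [_,_,_]

  det-columns : ∀ {n} (X : Matrix 3 n) s → maximalMinor X s ≃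
    [ column X (lookup s 0F) , column X (lookup s 1F) , column X (lookup s 2F) ]
  det-columns X s = pointwise λ n →
    solve 9 (λ a b c d e f g h i →
      -- The Laplace expansion as it normalises: the leading constants are powers of -1, the
      -- innermost `con 1ℚ` is the empty determinant, and each `con 0ℚ` ends a `sum`.
      con 1ℚ :* (a :* (con 1ℚ :* (e :* (con 1ℚ :* (i :* con 1ℚ) :+ con 0ℚ))
                     :+ (con (ℚ.- 1ℚ) :* (f :* (con 1ℚ :* (h :* con 1ℚ) :+ con 0ℚ)) :+ con 0ℚ)))
      :+ (con (ℚ.- 1ℚ) :* (b :* (con 1ℚ :* (d :* (con 1ℚ :* (i :* con 1ℚ) :+ con 0ℚ))
                     :+ (con (ℚ.- 1ℚ) :* (f :* (con 1ℚ :* (g :* con 1ℚ) :+ con 0ℚ)) :+ con 0ℚ)))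
      :+ (con 1ℚ :* (c :* (con 1ℚ :* (d :* (con 1ℚ :* (h :* con 1ℚ) :+ con 0ℚ))
                     :+ (con (ℚ.- 1ℚ) :* (e :* (con 1ℚ :* (g :* con 1ℚ) :+ con 0ℚ)) :+ con 0ℚ)))
      :+ con 0ℚ))
      := :volume (vec a d g) (vec b e h) (vec c f i))
      ≡.refl
      (seq (X 0F (lookup s 0F)) n) (seq (X 0F (lookup s 1F)) n) (seq (X 0F (lookup s 2F)) n)
      (seq (X 1F (lookup s 0F)) n) (seq (X 1F (lookup s 1F)) n) (seq (X 1F (lookup s 2F)) n)
      (seq (X 2F (lookup s 0F)) n) (seq (X 2F (lookup s 1F)) n) (seq (X 2F (lookup s 2F)) n)

dot : Vector ℚ → Vector ℚ → ℚ
dot r u = r 0F ℚ.* u 0F ℚ.+ (r 1F ℚ.* u 1F ℚ.+ (r 2F ℚ.* u 2F ℚ.+ 0ℚ))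

cross : Vector ℚ → Vector ℚ → Vector ℚ
cross u v = vec (u 1F ℚ.* v 2F ℚ.- u 2F ℚ.* v 1F)
                (u 2F ℚ.* v 0F ℚ.- u 0F ℚ.* v 2F)
                (u 0F ℚ.* v 1F ℚ.- u 1F ℚ.* v 0F)

apply : (r s t : Vector ℚ) → Vector ℚ → Vector ℚ
apply r s t u = vec (dot r u) (dot s u) (dot t u)

opaque
  unfolding volume

  volume-apply : ∀ r s t u v w →
    volume (apply r s t u) (apply r s t v) (apply r s t w) ≡ volume r s t ℚ.* volume u v w
  volume-apply r s t u v w = solve 18 (λ a b c d e f g h i j k l m n o p q r →
      let :dot = λ x y z a b c → x :* a :+ (y :* b :+ (z :* c :+ con 0ℚ))
          :apply = λ x y z → vec (:dot a b c x y z) (:dot d e f x y z) (:dot g h i x y z)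
      in :volume (:apply j k l) (:apply m n o) (:apply p q r) :=
         :volume (vec a b c) (vec d e f) (vec g h i) :* :volume (vec j k l) (vec m n o) (vec p q r))
    ≡.refl
    (r 0F) (r 1F) (r 2F) (s 0F) (s 1F) (s 2F) (t 0F) (t 1F) (t 2F)
    (u 0F) (u 1F) (u 2F) (v 0F) (v 1F) (v 2F) (w 0F) (w 1F) (w 2F)

opaque
  unfolding volume

  -- The cross products are the rows of the adjugate of the matrix with columns `u`, `v`, `w`; in
  -- dimension three its determinant is the square of the original one.
  volume-cross : ∀ u v w → volume (cross v w) (cross w u) (cross u v) ≡ volume u v w ℚ.* volume u v w
  volume-cross u v w = solve 9 (λ a b c d e f g h i →
      let :cross = λ a b c d e f → vec (b :* f :- c :* e) (c :* d :- a :* f) (a :* e :- b :* d)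
          :vol = :volume (vec a b c) (vec d e f) (vec g h i)
      in :volume (:cross d e f g h i) (:cross g h i a b c) (:cross a b c d e f) := :vol :* :vol)
    ≡.refl
    (u 0F) (u 1F) (u 2F) (v 0F) (v 1F) (v 2F) (w 0F) (w 1F) (w 2F)

-- By Cramer's rule, the coordinates of x in the basis u, v, w times the volume of the basis.
coordinates : (u v w x : Vector ℚ) → Vector ℚ
coordinates u v w x = vec (volume x v w) (volume u x w) (volume u v x)

opaque
  unfolding volume

  coordinates-apply : ∀ u v w x → ∀ i →
    coordinates u v w x i ≡ apply (cross v w) (cross w u) (cross u v) x i
  coordinates-apply u v w x = λ
    { 0F → solve 9 (λ a b c d e f x y z →
        :volume (vec x y z) (vec a b c) (vec d e f) := :triple a b c d e f x y z) ≡.refl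
        (v 0F) (v 1F) (v 2F) (w 0F) (w 1F) (w 2F) (x 0F) (x 1F) (x 2F)
    ; 1F → solve 9 (λ a b c d e f x y z →
        :volume (vec d e f) (vec x y z) (vec a b c) := :triple a b c d e f x y z) ≡.refl
        (w 0F) (w 1F) (w 2F) (u 0F) (u 1F) (u 2F) (x 0F) (x 1F) (x 2F)
    ; 2F → solve 9 (λ a b c d e f x y z →
        :volume (vec a b c) (vec d e f) (vec x y z) := :triple a b c d e f x y z) ≡.refl
        (u 0F) (u 1F) (u 2F) (v 0F) (v 1F) (v 2F) (x 0F) (x 1F) (x 2F)
    }
    where
    :triple : ∀ {n} (a b c d e f x y z : Polynomial n) → Polynomial n
    :triple a b c d e f x y z =
      (b :* f :- c :* e) :* x :+ ((c :* d :- a :* f) :* y :+ ((a :* e :- b :* d) :* z :+ con 0ℚ))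

opaque
  unfolding volume

  volume-cong : ∀ {u u′ v v′ w w′} → (∀ i → u i ≡ u′ i) → (∀ i → v i ≡ v′ i) → (∀ i → w i ≡ w′ i) →
                volume u v w ≡ volume u′ v′ w′
  volume-cong p q r
    rewrite p 0F | p 1F | p 2F | q 0F | q 1F | q 2F | r 0F | r 1F | r 2F = ≡.refl

-- Cramer's coordinates are the product with the adjugate, so volumes are multiplied by its
-- determinant.
volume-coordinates : ∀ u v w x y z →
  volume (coordinates u v w x) (coordinates u v w y) (coordinates u v w z) ≡
  volume u v w ℚ.* volume u v w ℚ.* volume x y z
volume-coordinates u v w x y z = ≡.trans
  (volume-cong (coordinates-apply u v w x) (coordinates-apply u v w y) (coordinates-apply u v w z))
  (≡.trans (volume-apply (cross v w) (cross w u) (cross u v) x y z)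
    (≡.cong (ℚ._* volume x y z) (volume-cross u v w)))

opaque
  unfolding volume

  -- The weights are 1/a, 1/b, 1/c with denominators cleared. They send a vector with coordinates
  -- (a, b, c) to a multiple of (1, 1, 1), which is how point 3 becomes the unit point.
  volume-scale : ∀ a b c u v w →
    let s : Vector ℚ → Vector ℚ
        s u = vec (b ℚ.* c ℚ.* u 0F) (a ℚ.* c ℚ.* u 1F) (a ℚ.* b ℚ.* u 2F)
    in volume (s u) (s v) (s w) ≡ (a ℚ.* b ℚ.* c) ℚ.* (a ℚ.* b ℚ.* c) ℚ.* volume u v w
  volume-scale a b c u v w = solve 12 (λ a b c d e f g h i j k l →
      let :s = λ x y z → vec (b :* c :* x) (a :* c :* y) (a :* b :* z)
      in :volume (:s d e f) (:s g h i) (:s j k l) :=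
         a :* b :* c :* (a :* b :* c) :* :volume (vec d e f) (vec g h i) (vec j k l))
    ≡.refl a b c
    (u 0F) (u 1F) (u 2F) (v 0F) (v 1F) (v 2F) (w 0F) (w 1F) (w 2F)

triple : ∀ {n} (i j k : Fin n) → Vec (Fin n) 3
triple i j k = i ∷ j ∷ k ∷ []

minor : ∀ {n} → Matrix 3 n → (i j k : Fin n) → ℝ
minor X i j k = [ column X i , column X j , column X k ]

det≃minor : ∀ {n} (X : Matrix 3 n) i j k → maximalMinor X (triple i j k) ≃ minor X i j k
det≃minor X i j k = det-columns X (triple i j k)

opaque
  unfolding [_,_,_]

  -- The formula of the bracket rebuilt from continuous maps: its terms agree with those of `minor`
  -- by `refl`, and continuity comes from the combinators.
  minorMap : ∀ {n} (i j k : Fin n) → ContinuousMap 3 n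
  minorMap i j k = entry 0F i ⊗ (entry 1F j ⊗ entry 2F k ⊕ ⊖ (entry 2F j ⊗ entry 1F k))
      ⊕ ⊖ (entry 1F i ⊗ (entry 0F j ⊗ entry 2F k ⊕ ⊖ (entry 2F j ⊗ entry 0F k)))
      ⊕ entry 2F i ⊗ (entry 0F j ⊗ entry 1F k ⊕ ⊖ (entry 1F j ⊗ entry 0F k))

  seq-minorMap : ∀ {n} i j k (X : Matrix 3 n) l → seq (fun (minorMap i j k) X) l ≡ seq (minor X i j k) l
  seq-minorMap i j k X l = ≡.refl

minor-cong : ∀ {n} {X Y : Matrix 3 n} i j k → X ≋ Y → minor X i j k ≃ minor Y i j k
minor-cong {X = X} {Y} i j k X≋Y = ≃-trans (pointwise λ l → ≡.sym (seq-minorMap i j k X l))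
  (≃-trans (fun-cong (minorMap i j k) {X} {Y} X≋Y) (pointwise (seq-minorMap i j k Y)))

[]-cong : ∀ {u u′ v v′ w w′} → (∀ i → u i ≃ u′ i) → (∀ i → v i ≃ v′ i) → (∀ i → w i ≃ w′ i) →
          [ u , v , w ] ≃ [ u′ , v′ , w′ ]
[]-cong {u} {u′} {v} {v′} {w} {w′} p q r = minor-cong
  {X = λ i j → vec u v w j i} {λ i j → vec u′ v′ w′ j i} 0F 1F 2F
  λ i → λ { 0F → close (p i) ; 1F → close (q i) ; 2F → close (r i) }

module _ (A : Matrix 3 3) where

  -- The determinant of `A`, taken along rows because `A ⊠ X` pairs the rows of `A` with the columns
  -- of `X`.
  rows : ℝ
  rows = [ A 0F , A 1F , A 2F ]

  seq-minor-⊠ : ∀ {n} (X : Matrix 3 n) i j k l →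
    seq (minor (A ⊠ X) i j k) l ≡ seq rows l ℚ.* seq (minor X i j k) l
  seq-minor-⊠ X i j k l = ≡.trans
    (seq-volume (column (A ⊠ X) i) (column (A ⊠ X) j) (column (A ⊠ X) k) l)
    (≡.trans (volume-cong (componentwise i) (componentwise j) (componentwise k))
      (≡.trans (volume-apply (at l (A 0F)) (at l (A 1F)) (at l (A 2F))
                             (at l (column X i)) (at l (column X j)) (at l (column X k)))
        (≡.cong₂ ℚ._*_ (≡.sym (seq-volume (A 0F) (A 1F) (A 2F) l))
                       (≡.sym (seq-volume (column X i) (column X j) (column X k) l)))))
    where
    componentwise : ∀ j i → at l (column (A ⊠ X) j) i ≡
      apply (at l (A 0F)) (at l (A 1F)) (at l (A 2F)) (at l (column X j)) i
    componentwise j 0F = ≡.refl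
    componentwise j 1F = ≡.refl
    componentwise j 2F = ≡.refl

opaque
  unfolding [_,_,_]

  minor-𝟙 : 1ᴿ ≃ minor 𝟙 0F 1F 2F
  minor-𝟙 = pointwise λ _ → ≡.refl

-- By multiplicativity `rows A` times a minor of the inverse is 1, and a factor of a product apart
-- from zero is apart from zero.
rows#0 : ∀ {A} → Invertible A → rows A #0
rows#0 {A} (B , AB≋𝟙 , _) = #0-*⁻ˡ {rows A} {minor B 0F 1F 2F}
  (#0-cong (≃-trans minor-𝟙 (≃-trans (≃-sym (minor-cong {X = A ⊠ B} {𝟙} 0F 1F 2F AB≋𝟙))
      (pointwise (seq-minor-⊠ A B 0F 1F 2F))))
    (0<⇒#0 (0<-fromℚ (ℚₚ.positive⁻¹ 1ℚ))))

-- Signs of rationals and the oriented matroid of a rational vector configuration.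

IsSign : ℚ → Sgn → Set
IsSign q neg = q ℚ.< 0ℚ
IsSign q zer = q ≡ 0ℚ
IsSign q pos = 0ℚ ℚ.< q

sign : ℚ → Sgn
sign q with ℚₚ.<-cmp q 0ℚ
... | tri< _ _ _ = neg
... | tri≈ _ _ _ = zer
... | tri> _ _ _ = pos

isSign : ∀ q → IsSign q (sign q)
isSign q with ℚₚ.<-cmp q 0ℚ
... | tri< q<0 _ _ = q<0
... | tri≈ _ q≡0 _ = q≡0
... | tri> _ _ 0<q = 0<q

sign-unique : ∀ {q} s → IsSign q s → sign q ≡ s
sign-unique {q} s is with ℚₚ.<-cmp q 0ℚ
sign-unique neg q<0 | tri< _ _ _ = ≡.refl
sign-unique zer q≡0 | tri< _ q≢0 _ = contradiction q≡0 q≢0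
sign-unique pos 0<q | tri< _ _ q≯0 = contradiction 0<q q≯0
sign-unique neg q<0 | tri≈ q≮0 _ _ = contradiction q<0 q≮0
sign-unique zer q≡0 | tri≈ _ _ _ = ≡.refl
sign-unique pos 0<q | tri≈ _ _ q≯0 = contradiction 0<q q≯0
sign-unique neg q<0 | tri> q≮0 _ _ = contradiction q<0 q≮0
sign-unique zer q≡0 | tri> _ q≢0 _ = contradiction q≡0 q≢0
sign-unique pos 0<q | tri> _ _ _ = ≡.refl

IsSign-neg : ∀ {q} s → IsSign q s → IsSign (ℚ.- q) (opp s)
IsSign-neg neg q<0    = ℚₚ.neg-antimono-< q<0
IsSign-neg zer ≡.refl = ≡.refl
IsSign-neg pos 0<q    = ℚₚ.neg-antimono-< 0<q

IsSign-pos* : ∀ {p q} t → 0ℚ ℚ.< p → IsSign q t → IsSign (p ℚ.* q) t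
IsSign-pos* {p} {q} neg 0<p q<0 =
  ≡.subst (p ℚ.* q ℚ.<_) (ℚₚ.*-zeroʳ p) (ℚₚ.*-monoʳ-<-pos p {{positive 0<p}} q<0)
IsSign-pos* {p} zer 0<p ≡.refl = ℚₚ.*-zeroʳ p
IsSign-pos* pos 0<p 0<q = 0<* 0<p 0<q

IsSign-* : ∀ {p q} s t → IsSign p s → IsSign q t → IsSign (p ℚ.* q) (s · t)
IsSign-* {p} {q} neg t p<0 q≷0 = ≡.subst (λ r → IsSign r (opp t))
  (solve 2 (λ p q → :- (:- p :* q) := p :* q) ≡.refl p q)
  (IsSign-neg t (IsSign-pos* t (ℚₚ.neg-antimono-< p<0) q≷0))
IsSign-* {q = q} zer t ≡.refl _ = ℚₚ.*-zeroˡ q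
IsSign-* pos t 0<p q≷0 = IsSign-pos* t 0<p q≷0

sign-neg : ∀ q → sign (ℚ.- q) ≡ opp (sign q)
sign-neg q = sign-unique _ (IsSign-neg (sign q) (isSign q))

sign-* : ∀ p q → sign (p ℚ.* q) ≡ sign p · sign q
sign-* p q = sign-unique _ (IsSign-* (sign p) (sign q) (isSign p) (isSign q))

NonNeg-sign⇒0≤ : ∀ q → NonNeg (sign q) → 0ℚ ℚ.≤ q
NonNeg-sign⇒0≤ q q≮0 = ℚₚ.≮⇒≥ (q≮0 ∘ sign-unique neg)

0≤⇒NonNeg-sign : ∀ q → 0ℚ ℚ.≤ q → NonNeg (sign q)
0≤⇒NonNeg-sign q 0≤q sign≡neg =
  ℚₚ.<-irrefl ≡.refl (ℚₚ.<-≤-trans (≡.subst (IsSign q) sign≡neg (isSign q)) 0≤q)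

opaque
  unfolding volume

  -- Cramer's rule expands `volume a b c` times `u` in `a`, `b`, `c`; applying the linear form
  -- `volume _ v w` gives the relation. Its three summands are exactly the products in the exchange
  -- axiom.
  grassmann-plücker : ∀ u v w a b c → volume u v w ℚ.* volume a b c ≡
    volume a v w ℚ.* volume u b c ℚ.+ (volume b v w ℚ.* volume a u c ℚ.+ volume c v w ℚ.* volume a b u)
  grassmann-plücker u v w a b c = solve 18 (λ u₀ u₁ u₂ v₀ v₁ v₂ w₀ w₁ w₂ a₀ a₁ a₂ b₀ b₁ b₂ c₀ c₁ c₂ →
      let u = vec u₀ u₁ u₂
          v = vec v₀ v₁ v₂
          w = vec w₀ w₁ w₂
          a = vec a₀ a₁ a₂
          b = vec b₀ b₁ b₂
          c = vec c₀ c₁ c₂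
      in :volume u v w :* :volume a b c := :volume a v w :* :volume u b c :+
         (:volume b v w :* :volume a u c :+ :volume c v w :* :volume a b u))
    ≡.refl
    (u 0F) (u 1F) (u 2F) (v 0F) (v 1F) (v 2F) (w 0F) (w 1F) (w 2F)
    (a 0F) (a 1F) (a 2F) (b 0F) (b 1F) (b 2F) (c 0F) (c 1F) (c 2F)

inversion? : (f : Fin 3 → Fin 3) (kl : Fin 3 × Fin 3) →
             Dec (proj₁ kl < proj₂ kl × f (proj₂ kl) < f (proj₁ kl))
inversion? f (k , l) = (k <? l) ×-dec (f l <? f k)

-- The sign of a permutation as a function of its three values: on literals it evaluates, which
-- permits the case analysis in `sign-permuted`.
sgn₃ : (a b c : Fin 3) → Sgn
sgn₃ a b c = foldr (λ _ → opp) pos (filter (inversion? (vec a b c)) (cartesianProduct (allFin 3) (allFin 3)))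

sgn≡sgn₃ : ∀ (σ : Permutation′ 3) → sgn σ ≡ sgn₃ (σ ⟨$⟩ʳ 0F) (σ ⟨$⟩ʳ 1F) (σ ⟨$⟩ʳ 2F)
sgn≡sgn₃ σ = ≡.cong (foldr (λ _ → opp) pos)
  (filter-≐ (inversion? f) (inversion? g)
    ( (λ {(k , l)} (k<l , fl<fk) → k<l , ≡.subst₂ _<_ (f≗g l) (f≗g k) fl<fk)
    , (λ {(k , l)} (k<l , gl<gk) → k<l , ≡.subst₂ _<_ (≡.sym (f≗g l)) (≡.sym (f≗g k)) gl<gk))
    (cartesianProduct (allFin 3) (allFin 3)))
  where
  f g : Fin 3 → Fin 3
  f = σ ⟨$⟩ʳ_
  g = vec (f 0F) (f 1F) (f 2F)
  f≗g : ∀ k → f k ≡ g k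
  f≗g 0F = ≡.refl
  f≗g 1F = ≡.refl
  f≗g 2F = ≡.refl

opaque
  unfolding volume

  swap₀₁ : ∀ u v w → volume v u w ≡ ℚ.- volume u v w
  swap₀₁ u v w = solve 9 (λ a b c d e f g h i →
      :volume (vec d e f) (vec a b c) (vec g h i) := :- :volume (vec a b c) (vec d e f) (vec g h i)) ≡.refl
    (u 0F) (u 1F) (u 2F) (v 0F) (v 1F) (v 2F) (w 0F) (w 1F) (w 2F)

opaque
  unfolding volume

  swap₁₂ : ∀ u v w → volume u w v ≡ ℚ.- volume u v w
  swap₁₂ u v w = solve 9 (λ a b c d e f g h i →
      :volume (vec a b c) (vec g h i) (vec d e f) := :- :volume (vec a b c) (vec d e f) (vec g h i)) ≡.refl
    (u 0F) (u 1F) (u 2F) (v 0F) (v 1F) (v 2F) (w 0F) (w 1F) (w 2F)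

opaque
  unfolding volume

  swap₀₂ : ∀ u v w → volume w v u ≡ ℚ.- volume u v w
  swap₀₂ u v w = solve 9 (λ a b c d e f g h i →
      :volume (vec g h i) (vec d e f) (vec a b c) := :- :volume (vec a b c) (vec d e f) (vec g h i)) ≡.refl
    (u 0F) (u 1F) (u 2F) (v 0F) (v 1F) (v 2F) (w 0F) (w 1F) (w 2F)

opaque
  unfolding volume

  rotate : ∀ u v w → volume v w u ≡ volume u v w
  rotate u v w = solve 9 (λ a b c d e f g h i →
      :volume (vec d e f) (vec g h i) (vec a b c) := :volume (vec a b c) (vec d e f) (vec g h i)) ≡.refl
    (u 0F) (u 1F) (u 2F) (v 0F) (v 1F) (v 2F) (w 0F) (w 1F) (w 2F)

opaque
  unfolding volume

  rotate² : ∀ u v w → volume w u v ≡ volume u v w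
  rotate² u v w = solve 9 (λ a b c d e f g h i →
      :volume (vec g h i) (vec a b c) (vec d e f) := :volume (vec a b c) (vec d e f) (vec g h i)) ≡.refl
    (u 0F) (u 1F) (u 2F) (v 0F) (v 1F) (v 2F) (w 0F) (w 1F) (w 2F)

sign-permuted : ∀ (f : Fin 3 → Vector ℚ) a b c → a ≢ b → a ≢ c → b ≢ c →
                sign (volume (f a) (f b) (f c)) ≡ sgn₃ a b c · sign (volume (f 0F) (f 1F) (f 2F))
sign-permuted f = permuted
  where
  swapped : ∀ {p q} → p ≡ ℚ.- q → sign p ≡ opp (sign q)
  swapped {q = q} p≡-q = ≡.trans (≡.cong sign p≡-q) (sign-neg q)

  permuted : ∀ a b c → a ≢ b → a ≢ c → b ≢ c →
             sign (volume (f a) (f b) (f c)) ≡ sgn₃ a b c · sign (volume (f 0F) (f 1F) (f 2F))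
  permuted 0F 0F _  a≢b _   _   = contradiction ≡.refl a≢b
  permuted 0F 1F 0F _   a≢c _   = contradiction ≡.refl a≢c
  permuted 0F 1F 1F _   _   b≢c = contradiction ≡.refl b≢c
  permuted 0F 1F 2F _   _   _   = ≡.refl
  permuted 0F 2F 0F _   a≢c _   = contradiction ≡.refl a≢c
  permuted 0F 2F 1F _   _   _   = swapped (swap₁₂ (f 0F) (f 1F) (f 2F))
  permuted 0F 2F 2F _   _   b≢c = contradiction ≡.refl b≢c
  permuted 1F 0F 0F _   _   b≢c = contradiction ≡.refl b≢c
  permuted 1F 0F 1F _   a≢c _   = contradiction ≡.refl a≢c
  permuted 1F 0F 2F _   _   _   = swapped (swap₀₁ (f 0F) (f 1F) (f 2F))
  permuted 1F 1F _  a≢b _   _   = contradiction ≡.refl a≢b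
  permuted 1F 2F 0F _   _   _   = ≡.cong sign (rotate (f 0F) (f 1F) (f 2F))
  permuted 1F 2F 1F _   a≢c _   = contradiction ≡.refl a≢c
  permuted 1F 2F 2F _   _   b≢c = contradiction ≡.refl b≢c
  permuted 2F 0F 0F _   _   b≢c = contradiction ≡.refl b≢c
  permuted 2F 0F 1F _   _   _   = ≡.cong sign (rotate² (f 0F) (f 1F) (f 2F))
  permuted 2F 0F 2F _   a≢c _   = contradiction ≡.refl a≢c
  permuted 2F 1F 0F _   _   _   = swapped (swap₀₂ (f 0F) (f 1F) (f 2F))
  permuted 2F 1F 1F _   _   b≢c = contradiction ≡.refl b≢c
  permuted 2F 1F 2F _   a≢c _   = contradiction ≡.refl a≢c
  permuted 2F 2F _  a≢b _   _   = contradiction ≡.refl a≢b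

module _ {n : ℕ} (x : Fin n → Vector ℚ) where

  chirotope : Vec (Fin n) 3 → Sgn
  chirotope s = sign (volume (x (lookup s 0F)) (x (lookup s 1F)) (x (lookup s 2F)))

  chirotope-alternating : ∀ i (σ : Permutation′ 3) →
    chirotope (tabulate λ k → lookup i (σ ⟨$⟩ʳ k)) ≡ sgn σ · chirotope i
  chirotope-alternating i σ = ≡.trans
    (sign-permuted (λ k → x (lookup i k)) (σ ⟨$⟩ʳ 0F) (σ ⟨$⟩ʳ 1F) (σ ⟨$⟩ʳ 2F)
      (σ-≢ λ ()) (σ-≢ λ ()) (σ-≢ λ ()))
    (≡.cong (_· chirotope i) (≡.sym (sgn≡sgn₃ σ)))
    where
    σ-≢ : ∀ {k l} → k ≢ l → σ ⟨$⟩ʳ k ≢ σ ⟨$⟩ʳ l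
    σ-≢ k≢l = k≢l ∘ Injection.injective (↔⇒↣ σ)

  chirotope-exchange : ∀ i j →
    (∀ k → NonNeg (chirotope (i [ 0F ]≔ lookup j k) · chirotope (j [ k ]≔ lookup i 0F))) →
    NonNeg (chirotope i · chirotope j)
  chirotope-exchange (u ∷ v ∷ w ∷ []) (a ∷ b ∷ c ∷ []) exchange =
    ≡.subst NonNeg (sign-* (vol u v w) (vol a b c))
      (0≤⇒NonNeg-sign (vol u v w ℚ.* vol a b c)
        (≡.subst (0ℚ ℚ.≤_) (≡.sym (grassmann-plücker (x u) (x v) (x w) (x a) (x b) (x c)))
          (ℚₚ.+-mono-≤ (summand (vol a v w) (vol u b c) (exchange 0F))
            (ℚₚ.+-mono-≤ (summand (vol b v w) (vol a u c) (exchange 1F))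
              (summand (vol c v w) (vol a b u) (exchange 2F))))))
    where
    vol : Fin n → Fin n → Fin n → ℚ
    vol i j k = volume (x i) (x j) (x k)
    summand : ∀ p q → NonNeg (sign p · sign q) → 0ℚ ℚ.≤ p ℚ.* q
    summand p q = NonNeg-sign⇒0≤ (p ℚ.* q) ∘ ≡.subst NonNeg (≡.sym (sign-* p q))

  vectorMatroid : ∃[ s ] chirotope s ≢ zer → OrientedMatroid 3 n
  vectorMatroid basis = record
    { χ = chirotope
    ; isChirotope = record
      { nonzero     = basis
      ; alternating = chirotope-alternating
      ; exchange    = chirotope-exchange
      }
    }

  matrix : Matrix 3 n
  matrix i j = fromℚ (x j i)

  det-matrix : ∀ s → maximalMinor matrix s ≃
               fromℚ (volume (x (lookup s 0F)) (x (lookup s 1F)) (x (lookup s 2F)))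
  det-matrix s = ≃-trans (det-columns matrix s)
    (pointwise (seq-volume (column matrix (lookup s 0F)) (column matrix (lookup s 1F))
                          (column matrix (lookup s 2F))))

fromℚ-neg : ∀ q → fromℚ (ℚ.- q) ≃ -ᴿ fromℚ q
fromℚ-neg q = pointwise λ _ → ≡.refl

HasSign-≃ : ∀ x {q} s → x ≃ fromℚ q → IsSign q s → HasSign x s
HasSign-≃ x {q} neg x≃q q<0 = 0<-neg⇒<ᴿ0 {x}
  (0<-cong (≃-trans (fromℚ-neg q) (neg-cong (≃-sym x≃q))) (0<-fromℚ (ℚₚ.neg-antimono-< q<0)))
HasSign-≃ x zer x≃q ≡.refl = close x≃q
HasSign-≃ x pos x≃q 0<q = 0<⇒0<ᴿ {x} (0<-cong (≃-sym x≃q) (0<-fromℚ 0<q))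

-- Two rational configurations with the same chirotope.

point : ℤ → ℤ → ℤ → Vector ℚ
point i j k = vec (i ℚ./ 1) (j ℚ./ 1) (k ℚ./ 1)

-- u = -1/2, v = 7/2 and u = -2, v = 4, with columns scaled by positive integers.
points₊ points₋ : Fin 13 → Vector ℚ
points₊ = lookup
  ( point (+ 1)   (+ 0)   (+ 0)
  ∷ point (+ 0)   (+ 1)   (+ 0)
  ∷ point (+ 0)   (+ 0)   (+ 1)
  ∷ point (+ 1)   (+ 1)   (+ 1)
  ∷ point (+ 2)   (- + 1) (+ 0)
  ∷ point (+ 0)   (+ 1)   (+ 1)
  ∷ point (+ 0)   (+ 3)   (+ 2)
  ∷ point (+ 2)   (+ 3)   (+ 2)
  ∷ point (+ 2)   (+ 2)   (+ 7)
  ∷ point (- + 6) (- + 8) (- + 11)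
  ∷ point (+ 2)   (+ 0)   (- + 3)
  ∷ point (+ 10)  (- + 2) (- + 7)
  ∷ point (+ 2)   (+ 0)   (- + 1)
  ∷ [])
points₋ = lookup
  ( point (+ 1)   (+ 0)   (+ 0)
  ∷ point (+ 0)   (+ 1)   (+ 0)
  ∷ point (+ 0)   (+ 0)   (+ 1)
  ∷ point (+ 1)   (+ 1)   (+ 1)
  ∷ point (+ 1)   (- + 2) (+ 0)
  ∷ point (+ 0)   (+ 1)   (+ 1)
  ∷ point (+ 0)   (+ 3)   (+ 1)
  ∷ point (+ 1)   (+ 3)   (+ 1)
  ∷ point (+ 1)   (+ 1)   (+ 4)
  ∷ point (- + 5) (- + 7) (- + 17)
  ∷ point (+ 1)   (+ 0)   (- + 5)
  ∷ point (+ 3)   (- + 2) (- + 8)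
  ∷ point (+ 1)   (+ 0)   (- + 2)
  ∷ [])

_≟_ : DecidableEquality Sgn
neg ≟ neg = yes ≡.refl
neg ≟ zer = no λ ()
neg ≟ pos = no λ ()
zer ≟ neg = no λ ()
zer ≟ zer = yes ≡.refl
zer ≟ pos = no λ ()
pos ≟ neg = no λ ()
pos ≟ zer = no λ ()
pos ≟ pos = yes ≡.refl

opaque
  unfolding volume

  -- All 13³ pairs of signs are evaluated. They agree outright, and not merely up to reversing some
  -- points, because the representatives in the two lists are oriented consistently.
  same-orientation : ∀ i j k →
    sign (volume (points₊ i) (points₊ j) (points₊ k)) ≡ sign (volume (points₋ i) (points₋ j) (points₋ k))
  same-orientation = from-yes (all? λ i → all? λ j → all? λ k →
    sign (volume (points₊ i) (points₊ j) (points₊ k)) ≟ sign (volume (points₋ i) (points₋ j) (points₋ k)))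

-- Elimination along the incidences.

open SetoidReasoning ≃-setoid

*-zero : ∀ {x} c → x ≃ 0ᴿ → x *ᴿ c ≃ 0ᴿ
*-zero {x} c x≃0 = begin
  x *ᴿ c  ≈⟨ *-cong {x} {0ᴿ} {c} {c} x≃0 ≃-refl ⟩
  0ᴿ *ᴿ c ≈⟨ pointwise (λ n → ℚₚ.*-zeroˡ (seq c n)) ⟩
  0ᴿ      ∎

+-zero : ∀ {x y} → x ≃ 0ᴿ → y ≃ 0ᴿ → x +ᴿ y ≃ 0ᴿ
+-zero {x} {y} x≃0 y≃0 = begin
  x +ᴿ y   ≈⟨ +-cong {x} {0ᴿ} {y} {0ᴿ} x≃0 y≃0 ⟩
  0ᴿ +ᴿ 0ᴿ ≈⟨ pointwise (λ n → ℚₚ.+-identityʳ 0ℚ) ⟩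
  0ᴿ       ∎

difference-zero : ∀ {x y} → x -ᴿ y ≃ 0ᴿ → x ≃ y
difference-zero {x} {y} x-y≃0 = begin
  x              ≈⟨ pointwise (λ n → split (seq x n) (seq y n)) ⟩
  (x -ᴿ y) +ᴿ y ≈⟨ +-cong {x -ᴿ y} {0ᴿ} {y} {y} x-y≃0 ≃-refl ⟩
  0ᴿ +ᴿ y       ≈⟨ pointwise (λ n → ℚₚ.+-identityˡ (seq y n)) ⟩
  y              ∎
  where
  split : ∀ p q → p ≡ (p ℚ.- q) ℚ.+ q
  split = solve 2 (λ p q → p := (p :- q) :+ q) ≡.refl

-- The form of every elimination step: a combination `z` of quantities known to vanish factors as
-- `κ *ᴿ E`, and `κ` is cancelled.
vanish : ∀ κ E {z} → κ #0 → z ≃ 0ᴿ → z ≃ κ *ᴿ E → E ≃ 0ᴿ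
vanish κ E κ#0 z≃0 z≃κE = *-cancelˡ-#0 {κ} {E} κ#0 (≃-trans (≃-sym z≃κE) z≃0)

scale-zero : ∀ {x} c → x ≃ 0ᴿ → c *ᴿ x ≃ 0ᴿ
scale-zero {x} c x≃0 = begin
  c *ᴿ x ≈⟨ pointwise (λ n → ℚₚ.*-comm (seq c n) (seq x n)) ⟩
  x *ᴿ c ≈⟨ *-zero c x≃0 ⟩
  0ᴿ     ∎

opaque
  unfolding [_,_,_] volume

  bracket-uuv : ∀ u v → [ u , u , v ] ≃ 0ᴿ
  bracket-uuv u v = pointwise λ n → solve 6 (λ a b c d e f →
      :volume (vec a b c) (vec a b c) (vec d e f) := con 0ℚ) ≡.refl
    (seq (u 0F) n) (seq (u 1F) n) (seq (u 2F) n) (seq (v 0F) n) (seq (v 1F) n) (seq (v 2F) n)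

  bracket-uvu : ∀ u v → [ u , v , u ] ≃ 0ᴿ
  bracket-uvu u v = pointwise λ n → solve 6 (λ a b c d e f →
      :volume (vec a b c) (vec d e f) (vec a b c) := con 0ℚ) ≡.refl
    (seq (u 0F) n) (seq (u 1F) n) (seq (u 2F) n) (seq (v 0F) n) (seq (v 1F) n) (seq (v 2F) n)

  bracket-uvv : ∀ u v → [ u , v , v ] ≃ 0ᴿ
  bracket-uvv u v = pointwise λ n → solve 6 (λ a b c d e f →
      :volume (vec a b c) (vec d e f) (vec d e f) := con 0ℚ) ≡.refl
    (seq (u 0F) n) (seq (u 1F) n) (seq (u 2F) n) (seq (v 0F) n) (seq (v 1F) n) (seq (v 2F) n)

opaque
  unfolding [_,_,_] volume

  -- Two frame points in a bracket leave, up to a factor, one coordinate of the third vector or a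
  -- difference of two. Collinearity with frame points thus yields the normal forms `y₄` to `y₁₀`.
  axes₀₁ : ∀ s t w → [ vec s 0ᴿ 0ᴿ , vec 0ᴿ t 0ᴿ , w ] ≃ (s *ᴿ t) *ᴿ w 2F
  axes₀₁ s t w = pointwise λ n → solve 5 (λ s t x y z →
      :volume (vec s (con 0ℚ) (con 0ℚ)) (vec (con 0ℚ) t (con 0ℚ)) (vec x y z) := (s :* t) :* z) ≡.refl
    (seq s n) (seq t n) (seq (w 0F) n) (seq (w 1F) n) (seq (w 2F) n)

  axes₁₂ : ∀ s t w → [ vec 0ᴿ s 0ᴿ , vec 0ᴿ 0ᴿ t , w ] ≃ (s *ᴿ t) *ᴿ w 0F
  axes₁₂ s t w = pointwise λ n → solve 5 (λ s t x y z →
      :volume (vec (con 0ℚ) s (con 0ℚ)) (vec (con 0ℚ) (con 0ℚ) t) (vec x y z) := (s :* t) :* x) ≡.refl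
    (seq s n) (seq t n) (seq (w 0F) n) (seq (w 1F) n) (seq (w 2F) n)

  axes₀₂ : ∀ s t w → [ vec s 0ᴿ 0ᴿ , vec 0ᴿ 0ᴿ t , w ] ≃ (s *ᴿ t) *ᴿ (0ᴿ -ᴿ w 1F)
  axes₀₂ s t w = pointwise λ n → solve 5 (λ s t x y z →
      :volume (vec s (con 0ℚ) (con 0ℚ)) (vec (con 0ℚ) (con 0ℚ) t) (vec x y z) := (s :* t) :* (con 0ℚ :- y)) ≡.refl
    (seq s n) (seq t n) (seq (w 0F) n) (seq (w 1F) n) (seq (w 2F) n)

  axis-unit₀ : ∀ s e w → [ vec s 0ᴿ 0ᴿ , vec e e e , w ] ≃ (s *ᴿ e) *ᴿ (w 2F -ᴿ w 1F)
  axis-unit₀ s e w = pointwise λ n → solve 5 (λ s e x y z →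
      :volume (vec s (con 0ℚ) (con 0ℚ)) (vec e e e) (vec x y z) := (s :* e) :* (z :- y)) ≡.refl
    (seq s n) (seq e n) (seq (w 0F) n) (seq (w 1F) n) (seq (w 2F) n)

  axis-unit₁ : ∀ s e w → [ vec 0ᴿ s 0ᴿ , vec e e e , w ] ≃ (s *ᴿ e) *ᴿ (w 0F -ᴿ w 2F)
  axis-unit₁ s e w = pointwise λ n → solve 5 (λ s e x y z →
      :volume (vec (con 0ℚ) s (con 0ℚ)) (vec e e e) (vec x y z) := (s :* e) :* (x :- z)) ≡.refl
    (seq s n) (seq e n) (seq (w 0F) n) (seq (w 1F) n) (seq (w 2F) n)

  axis-unit₂ : ∀ s e w → [ vec 0ᴿ 0ᴿ s , vec e e e , w ] ≃ (s *ᴿ e) *ᴿ (w 1F -ᴿ w 0F)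
  axis-unit₂ s e w = pointwise λ n → solve 5 (λ s e x y z →
      :volume (vec (con 0ℚ) (con 0ℚ) s) (vec e e e) (vec x y z) := (s :* e) :* (y :- x)) ≡.refl
    (seq s n) (seq e n) (seq (w 0F) n) (seq (w 1F) n) (seq (w 2F) n)

-- Homogeneous version of the parametrisation: u = `q / p` and v = `h / g`, while `s`, `e`, `f` are
-- the free scales of the points 0, 3, 5.
module Elimination
  (p q e f s b₆ c₆ b₇ c₇ g h a₉ b₉ c₉ a c x y z : ℝ)
  (p#0 : p #0) (q#0 : q #0) (e#0 : e #0) (f#0 : f #0) (s#0 : s #0)
  (c₆#0 : c₆ #0) (c₇#0 : c₇ #0) (g#0 : g #0) (a₉#0 : a₉ #0)
  (D₃₄₆≃0 : [ vec e e e , vec p q 0ᴿ , vec 0ᴿ b₆ c₆ ] ≃ 0ᴿ)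
  (D₀₆₇≃0 : [ vec s 0ᴿ 0ᴿ , vec 0ᴿ b₆ c₆ , vec c₇ b₇ c₇ ] ≃ 0ᴿ)
  (D₄₅₉≃0 : [ vec p q 0ᴿ , vec 0ᴿ f f , vec a₉ b₉ c₉ ] ≃ 0ᴿ)
  (D₇₈₉≃0 : [ vec c₇ b₇ c₇ , vec g g h , vec a₉ b₉ c₉ ] ≃ 0ᴿ)
  (D₃₉₁₀≃0 : [ vec e e e , vec a₉ b₉ c₉ , vec a 0ᴿ c ] ≃ 0ᴿ)
  (D₀₈₁₁≃0 : [ vec s 0ᴿ 0ᴿ , vec g g h , vec x y z ] ≃ 0ᴿ)
  (D₅₇₁₁≃0 : [ vec 0ᴿ f f , vec c₇ b₇ c₇ , vec x y z ] ≃ 0ᴿ)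
  (D₅₇₈#0 : [ vec 0ᴿ f f , vec c₇ b₇ c₇ , vec g g h ] #0)
  (D₄₁₀₁₁#0 : [ vec p q 0ᴿ , vec a 0ᴿ c , vec x y z ] #0)
  where

  -- a₉ : c₉ = β : α for point 9 and a : c = γ : β for point 10.
  private
    α β γ E₆ E₇ F₇ G₉ K₉ J L S T₀ T Q : ℝ
    α = p *ᴿ g -ᴿ p *ᴿ h +ᴿ q *ᴿ h +ᴿ q *ᴿ h -ᴿ q *ᴿ g
    β = p *ᴿ g +ᴿ q *ᴿ g -ᴿ p *ᴿ h
    γ = p *ᴿ h +ᴿ q *ᴿ g -ᴿ p *ᴿ g
    -- Vanishing of `E₆` and `F₇` says that the second and third coordinates of 6 and 7 have ratio
    -- 1-u; `E₇` transfers this ratio from 6 to 7.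
    E₆ = p *ᴿ b₆ -ᴿ (p -ᴿ q) *ᴿ c₆
    E₇ = b₆ *ᴿ c₇ -ᴿ c₆ *ᴿ b₇
    F₇ = p *ᴿ b₇ -ᴿ (p -ᴿ q) *ᴿ c₇
    G₉ = q *ᴿ a₉ -ᴿ p *ᴿ (b₉ -ᴿ c₉)
    K₉ = a₉ *ᴿ α -ᴿ c₉ *ᴿ β
    J = c *ᴿ (b₉ -ᴿ a₉) +ᴿ a *ᴿ (c₉ -ᴿ b₉)
    L = c *ᴿ γ -ᴿ β *ᴿ a
    S = g *ᴿ z -ᴿ h *ᴿ y
    T₀ = c₇ *ᴿ (y -ᴿ z +ᴿ x) -ᴿ b₇ *ᴿ x
    T = p *ᴿ (y -ᴿ z) +ᴿ q *ᴿ x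
    -- `Q` is `p g²` times uv + (v-1)(v-2).
    Q = q *ᴿ g *ᴿ h +ᴿ p *ᴿ (h -ᴿ g) *ᴿ (h -ᴿ g -ᴿ g)

  opaque
    unfolding [_,_,_] volume

    E₆≃0 : E₆ ≃ 0ᴿ
    E₆≃0 = vanish e E₆ e#0 D₃₄₆≃0
      (pointwise λ n → solve 5 (λ p q e b₆ c₆ →
        let :E₆ = p :* b₆ :- (p :- q) :* c₆
        in (:volume (vec e e e) (vec p q (con 0ℚ)) (vec (con 0ℚ) b₆ c₆)) :=
           e :* :E₆) ≡.refl
        (seq p n) (seq q n) (seq e n) (seq b₆ n) (seq c₆ n))

    E₇≃0 : E₇ ≃ 0ᴿ
    E₇≃0 = vanish s E₇ s#0 D₀₆₇≃0
      (pointwise λ n → solve 5 (λ s b₆ c₆ b₇ c₇ →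
        let :E₇ = b₆ :* c₇ :- c₆ :* b₇
        in (:volume (vec s (con 0ℚ) (con 0ℚ)) (vec (con 0ℚ) b₆ c₆) (vec c₇ b₇ c₇)) :=
           s :* :E₇) ≡.refl
        (seq s n) (seq b₆ n) (seq c₆ n) (seq b₇ n) (seq c₇ n))

    F₇≃0 : F₇ ≃ 0ᴿ
    F₇≃0 = vanish c₆ F₇ c₆#0 (+-zero (*-zero c₇ E₆≃0) (*-zero ( -ᴿ p) E₇≃0))
      (pointwise λ n → solve 6 (λ p q b₆ c₆ b₇ c₇ →
        let :E₆ = p :* b₆ :- (p :- q) :* c₆
            :E₇ = b₆ :* c₇ :- c₆ :* b₇
            :F₇ = p :* b₇ :- (p :- q) :* c₇
        in :E₆ :* c₇ :+ :E₇ :* (:- p) :=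
           c₆ :* :F₇) ≡.refl
        (seq p n) (seq q n) (seq b₆ n) (seq c₆ n) (seq b₇ n) (seq c₇ n))

    G₉≃0 : G₉ ≃ 0ᴿ
    G₉≃0 = vanish f G₉ f#0 D₄₅₉≃0
      (pointwise λ n → solve 6 (λ p q f a₉ b₉ c₉ →
        let :G₉ = q :* a₉ :- p :* (b₉ :- c₉)
        in (:volume (vec p q (con 0ℚ)) (vec (con 0ℚ) f f) (vec a₉ b₉ c₉)) :=
           f :* :G₉) ≡.refl
        (seq p n) (seq q n) (seq f n) (seq a₉ n) (seq b₉ n) (seq c₉ n))

    -- Point 9 lies on 78 and 45: `F₇` removes `b₇` from the first condition and `G₉` removes `b₉`.
    K₉≃0 : K₉ ≃ 0ᴿ
    K₉≃0 = vanish c₇ K₉ c₇#0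
      (+-zero (*-zero ( -ᴿ p) D₇₈₉≃0) (+-zero (*-zero (h *ᴿ a₉ -ᴿ g *ᴿ c₉) F₇≃0) (*-zero (c₇ *ᴿ (h -ᴿ g)) G₉≃0)))
      (pointwise λ n → solve 9 (λ p q b₇ c₇ g h a₉ b₉ c₉ →
        let :α = p :* g :- p :* h :+ q :* h :+ q :* h :- q :* g
            :β = p :* g :+ q :* g :- p :* h
            :F₇ = p :* b₇ :- (p :- q) :* c₇
            :G₉ = q :* a₉ :- p :* (b₉ :- c₉)
            :K₉ = a₉ :* :α :- c₉ :* :β
        in (:volume (vec c₇ b₇ c₇) (vec g g h) (vec a₉ b₉ c₉)) :* (:- p) :+
             (:F₇ :* (h :* a₉ :- g :* c₉) :+ :G₉ :* (c₇ :* (h :- g))) :=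
           c₇ :* :K₉) ≡.refl
        (seq p n) (seq q n) (seq b₇ n) (seq c₇ n) (seq g n) (seq h n) (seq a₉ n) (seq b₉ n) (seq c₉ n))

    J≃0 : J ≃ 0ᴿ
    J≃0 = vanish e J e#0 D₃₉₁₀≃0
      (pointwise λ n → solve 6 (λ e a₉ b₉ c₉ a c →
        let :J = c :* (b₉ :- a₉) :+ a :* (c₉ :- b₉)
        in (:volume (vec e e e) (vec a₉ b₉ c₉) (vec a (con 0ℚ) c)) :=
           e :* :J) ≡.refl
        (seq e n) (seq a₉ n) (seq b₉ n) (seq c₉ n) (seq a n) (seq c n))

    -- Point 10 lies on 39: `G₉` removes `b₉` from `J`, then `K₉` removes `c₉`, and `a₉ *ᴿ q` splits
    -- off.
    L≃0 : L ≃ 0ᴿ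
    L≃0 = vanish (a₉ *ᴿ q) L (#0-* {a₉} {q} a₉#0 q#0)
      (+-zero (*-zero (β *ᴿ p) J≃0) (+-zero (*-zero (β *ᴿ (c -ᴿ a)) G₉≃0) (*-zero (p *ᴿ c) K₉≃0)))
      (pointwise λ n → solve 9 (λ p q g h a₉ b₉ c₉ a c →
        let :α = p :* g :- p :* h :+ q :* h :+ q :* h :- q :* g
            :β = p :* g :+ q :* g :- p :* h
            :γ = p :* h :+ q :* g :- p :* g
            :G₉ = q :* a₉ :- p :* (b₉ :- c₉)
            :K₉ = a₉ :* :α :- c₉ :* :β
            :J = c :* (b₉ :- a₉) :+ a :* (c₉ :- b₉)
            :L = c :* :γ :- :β :* a
        in :J :* (:β :* p) :+ (:G₉ :* (:β :* (c :- a)) :+ :K₉ :* (p :* c)) :=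
           (a₉ :* q) :* :L) ≡.refl
        (seq p n) (seq q n) (seq g n) (seq h n) (seq a₉ n) (seq b₉ n) (seq c₉ n) (seq a n) (seq c n))

    S≃0 : S ≃ 0ᴿ
    S≃0 = vanish s S s#0 D₀₈₁₁≃0
      (pointwise λ n → solve 6 (λ s g h x y z →
        let :S = g :* z :- h :* y
        in (:volume (vec s (con 0ℚ) (con 0ℚ)) (vec g g h) (vec x y z)) :=
           s :* :S) ≡.refl
        (seq s n) (seq g n) (seq h n) (seq x n) (seq y n) (seq z n))

    T₀≃0 : T₀ ≃ 0ᴿ
    T₀≃0 = vanish f T₀ f#0 D₅₇₁₁≃0
      (pointwise λ n → solve 6 (λ f b₇ c₇ x y z →
        let :T₀ = c₇ :* (y :- z :+ x) :- b₇ :* x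
        in (:volume (vec (con 0ℚ) f f) (vec c₇ b₇ c₇) (vec x y z)) :=
           f :* :T₀) ≡.refl
        (seq f n) (seq b₇ n) (seq c₇ n) (seq x n) (seq y n) (seq z n))

    T≃0 : T ≃ 0ᴿ
    T≃0 = vanish c₇ T c₇#0 (+-zero (*-zero p T₀≃0) (*-zero x F₇≃0))
      (pointwise λ n → solve 7 (λ p q b₇ c₇ x y z →
        let :F₇ = p :* b₇ :- (p :- q) :* c₇
            :T₀ = c₇ :* (y :- z :+ x) :- b₇ :* x
            :T = p :* (y :- z) :+ q :* x
        in :T₀ :* p :+ :F₇ :* x :=
           c₇ :* :T) ≡.refl
        (seq p n) (seq q n) (seq b₇ n) (seq c₇ n) (seq x n) (seq y n) (seq z n))

    -- Modulo `F₇`, the bracket of 5, 7, 8 times `p` equals `f c₇ β`, so the gap given by the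
    -- non-collinearity of these points passes to `β`.
    β#0 : β #0
    β#0 = #0-*⁻ʳ {f *ᴿ c₇} {β} (#0-cong (difference-zero (≃-trans
      (pointwise λ n → solve 7 (λ p q f b₇ c₇ g h →
        let :β = p :* g :+ q :* g :- p :* h
            :F₇ = p :* b₇ :- (p :- q) :* c₇
        in (:volume (vec (con 0ℚ) f f) (vec c₇ b₇ c₇) (vec g g h)) :* p :- (f :* c₇) :* :β :=
           :F₇ :* (:- (f :* g))) ≡.refl
        (seq p n) (seq q n) (seq f n) (seq b₇ n) (seq c₇ n) (seq g n) (seq h n))
      (*-zero ( -ᴿ (f *ᴿ g)) F₇≃0)))
      (#0-* {[ vec 0ᴿ f f , vec c₇ b₇ c₇ , vec g g h ]} {p} D₅₇₈#0 p#0))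

    -- Modulo `L`, `S` and `T`, the bracket of 4, 10, 11 times `g β` is `-(p + q) y c Q`. The gap of
    -- the left side passes to the factor `p + q`, whatever the sign of `Q`.
    p+q#0 : p +ᴿ q #0
    p+q#0 = #0-*⁻ˡ {p +ᴿ q} { -ᴿ (y *ᴿ c *ᴿ Q)} (#0-cong (difference-zero (≃-trans
      (pointwise λ n → solve 9 (λ p q g h a c x y z →
        let :β = p :* g :+ q :* g :- p :* h
            :γ = p :* h :+ q :* g :- p :* g
            :L = c :* :γ :- :β :* a
            :S = g :* z :- h :* y
            :T = p :* (y :- z) :+ q :* x
            :Q = q :* g :* h :+ p :* (h :- g) :* (h :- g :- g)
        in (:volume (vec p q (con 0ℚ)) (vec a (con 0ℚ) c) (vec x y z)) :* (g :* :β) :-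
             (p :+ q) :* (:- (y :* c :* :Q)) :=
           :L :* (y :* q :* h) :+ (:S :* (:β :* (p :* c :- q :* a)) :+ :T :* (:β :* g :* c))) ≡.refl
        (seq p n) (seq q n) (seq g n) (seq h n) (seq a n) (seq c n) (seq x n) (seq y n) (seq z n))
      (+-zero (*-zero (y *ᴿ q *ᴿ h) L≃0)
        (+-zero (*-zero (β *ᴿ (p *ᴿ c -ᴿ q *ᴿ a)) S≃0) (*-zero (β *ᴿ g *ᴿ c) T≃0)))))
      (#0-* {[ vec p q 0ᴿ , vec a 0ᴿ c , vec x y z ]} {g *ᴿ β} D₄₁₀₁₁#0 (#0-* {g} {β} g#0 β#0)))

-- p (p + q) with p and q divided by the nonzero minor [0 1 3]; here a = [3 1 2],
-- b = [0 3 2], and the arguments p, q are [4 1 2], [0 4 2].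
form : ℚ → ℚ → ℚ → ℚ → ℚ
form b p a q = b ℚ.* p ℚ.* (b ℚ.* p ℚ.+ a ℚ.* q)

form-cong : ∀ {b b′ p p′ a a′ q q′} → b ≡ b′ → p ≡ p′ → a ≡ a′ → q ≡ q′ → form b p a q ≡ form b′ p′ a′ q′
form-cong ≡.refl ≡.refl ≡.refl ≡.refl = ≡.refl

-- The discriminant as a continuous semi-invariant.

opaque
  discriminant : ContinuousMap 3 13
  discriminant = (minorMap 0F 3F 2F ⊗ minorMap 4F 1F 2F) ⊗
      (minorMap 0F 3F 2F ⊗ minorMap 4F 1F 2F ⊕ minorMap 3F 1F 2F ⊗ minorMap 0F 4F 2F)

  seq-discriminant : ∀ X n → seq (fun discriminant X) n ≡
    form (seq (minor X 0F 3F 2F) n) (seq (minor X 4F 1F 2F) n)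
         (seq (minor X 3F 1F 2F) n) (seq (minor X 0F 4F 2F) n)
  seq-discriminant X n = form-cong (seq-minorMap 0F 3F 2F X n) (seq-minorMap 4F 1F 2F X n)
      (seq-minorMap 3F 1F 2F X n) (seq-minorMap 0F 4F 2F X n)

opaque
  det⁴ : Matrix 3 3 → ℝ
  det⁴ A = rows A *ᴿ rows A *ᴿ (rows A *ᴿ rows A)

  0<-det⁴ : ∀ {A} → Invertible A → 0< det⁴ A
  0<-det⁴ {A} inv = 0<-* {rows A *ᴿ rows A} {rows A *ᴿ rows A} 0<det² 0<det²
    where
    0<det² : 0< rows A *ᴿ rows A
    0<det² = 0<-square {rows A} (rows#0 {A} inv)

  discriminant-⊠ : ∀ A X → fun discriminant (A ⊠ X) ≃ det⁴ A *ᴿ fun discriminant X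
  discriminant-⊠ A X = pointwise λ n → ≡.trans (seq-discriminant (A ⊠ X) n)
    (≡.trans (homogeneous (seq (rows A) n)
        (seq-minor-⊠ A X 0F 3F 2F n) (seq-minor-⊠ A X 4F 1F 2F n)
        (seq-minor-⊠ A X 3F 1F 2F n) (seq-minor-⊠ A X 0F 4F 2F n))
      (≡.cong (seq (rows A) n ℚ.* seq (rows A) n ℚ.* (seq (rows A) n ℚ.* seq (rows A) n) ℚ.*_)
        (≡.sym (seq-discriminant X n))))
    where
    homogeneous : ∀ d {b p a q b′ p′ a′ q′} →
      b′ ≡ d ℚ.* b → p′ ≡ d ℚ.* p → a′ ≡ d ℚ.* a → q′ ≡ d ℚ.* q →
      form b′ p′ a′ q′ ≡ d ℚ.* d ℚ.* (d ℚ.* d) ℚ.* form b p a q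
    homogeneous d {b} {p} {a} {q} ≡.refl ≡.refl ≡.refl ≡.refl = solve 5 (λ d b p a q →
      d :* b :* (d :* p) :* (d :* b :* (d :* p) :+ d :* a :* (d :* q)) :=
      d :* d :* (d :* d) :* (b :* p :* (b :* p :+ a :* q))) ≡.refl d b p a q

-- Formulated for any `f` so that `discriminant` and its negative give the two open sets by one
-- construction.
SemiInvariant : ContinuousMap 3 13 → Set
SemiInvariant f = ∀ A X → fun f (A ⊠ X) ≃ det⁴ A *ᴿ fun f X

⊖-semiInvariant : ∀ f → SemiInvariant f → SemiInvariant (⊖ f)
⊖-semiInvariant f f-⊠ A X = ≃-trans (neg-cong {fun f (A ⊠ X)} {det⁴ A *ᴿ fun f X} (f-⊠ A X))
  (pointwise λ n → pull (seq (det⁴ A) n) (seq (fun f X) n))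
  where
  pull : ∀ d p → ℚ.- (d ℚ.* p) ≡ d ℚ.* (ℚ.- p)
  pull = solve 2 (λ d p → :- (d :* p) := d :* (:- p)) ≡.refl

0<-LinearlyEquivalent : ∀ f → SemiInvariant f →
  ∀ {X Y} → LinearlyEquivalent X Y → 0< fun f X → 0< fun f Y
0<-LinearlyEquivalent f f-⊠ {X} {Y} (A , inv , Y≋AX) 0<fX = 0<-cong {det⁴ A *ᴿ fun f X} {fun f Y}
  (≃-sym (≃-trans (fun-cong f {Y} {A ⊠ X} Y≋AX) (f-⊠ A X)))
  (0<-* {det⁴ A} {fun f X} (0<-det⁴ {A} inv) 0<fX)

-- Incidences of a realization and its normalisation to the projective frame.

pattern 10F = suc 9F
pattern 11F = suc 10F

-- Concatenated indices: m₃₉₁₀ concerns the minor of the points 3, 9, 10.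
record Incidences (X : Matrix 3 13) : Set where
  field
    m₀₁₄ : minor X 0F 1F 4F ≃ 0ᴿ
    m₁₂₅ : minor X 1F 2F 5F ≃ 0ᴿ
    m₀₃₅ : minor X 0F 3F 5F ≃ 0ᴿ
    m₁₂₆ : minor X 1F 2F 6F ≃ 0ᴿ
    m₃₄₆ : minor X 3F 4F 6F ≃ 0ᴿ
    m₁₃₇ : minor X 1F 3F 7F ≃ 0ᴿ
    m₀₆₇ : minor X 0F 6F 7F ≃ 0ᴿ
    m₂₃₈ : minor X 2F 3F 8F ≃ 0ᴿ
    m₄₅₉ : minor X 4F 5F 9F ≃ 0ᴿ
    m₇₈₉ : minor X 7F 8F 9F ≃ 0ᴿ
    m₀₂₁₀ : minor X 0F 2F 10F ≃ 0ᴿ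
    m₃₉₁₀ : minor X 3F 9F 10F ≃ 0ᴿ
    m₀₈₁₁ : minor X 0F 8F 11F ≃ 0ᴿ
    m₅₇₁₁ : minor X 5F 7F 11F ≃ 0ᴿ
    m₀₁₂ : minor X 0F 1F 2F #0
    m₃₁₂ : minor X 3F 1F 2F #0
    m₀₃₂ : minor X 0F 3F 2F #0
    m₀₁₃ : minor X 0F 1F 3F #0
    m₄₁₂ : minor X 4F 1F 2F #0
    m₀₄₂ : minor X 0F 4F 2F #0
    m₀₁₅ : minor X 0F 1F 5F #0
    m₀₁₆ : minor X 0F 1F 6F #0
    m₀₁₇ : minor X 0F 1F 7F #0
    m₈₁₂ : minor X 8F 1F 2F #0
    m₉₁₂ : minor X 9F 1F 2F #0
    m₅₇₈ : minor X 5F 7F 8F #0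
    m₄₁₀₁₁ : minor X 4F 10F 11F #0

opaque
  unfolding volume

  -- The premises record only which minors vanish, so realizations of the chirotope and of its
  -- negative are treated alike. Each field is settled by evaluating a sign at `points₊`.
  incidences : ∀ X → (∀ i j k → chirotope points₊ (triple i j k) ≡ zer → minor X i j k ≃ 0ᴿ) →
               (∀ i j k → chirotope points₊ (triple i j k) ≢ zer → minor X i j k #0) → Incidences X
  incidences X zero nonzero = record
    { m₀₁₄ = zero 0F 1F 4F ≡.refl
    ; m₁₂₅ = zero 1F 2F 5F ≡.refl
    ; m₀₃₅ = zero 0F 3F 5F ≡.refl
    ; m₁₂₆ = zero 1F 2F 6F ≡.refl
    ; m₃₄₆ = zero 3F 4F 6F ≡.refl
    ; m₁₃₇ = zero 1F 3F 7F ≡.refl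
    ; m₀₆₇ = zero 0F 6F 7F ≡.refl
    ; m₂₃₈ = zero 2F 3F 8F ≡.refl
    ; m₄₅₉ = zero 4F 5F 9F ≡.refl
    ; m₇₈₉ = zero 7F 8F 9F ≡.refl
    ; m₀₂₁₀ = zero 0F 2F 10F ≡.refl
    ; m₃₉₁₀ = zero 3F 9F 10F ≡.refl
    ; m₀₈₁₁ = zero 0F 8F 11F ≡.refl
    ; m₅₇₁₁ = zero 5F 7F 11F ≡.refl
    ; m₀₁₂ = nonzero 0F 1F 2F λ ()
    ; m₃₁₂ = nonzero 3F 1F 2F λ ()
    ; m₀₃₂ = nonzero 0F 3F 2F λ ()
    ; m₀₁₃ = nonzero 0F 1F 3F λ ()
    ; m₄₁₂ = nonzero 4F 1F 2F λ ()
    ; m₀₄₂ = nonzero 0F 4F 2F λ ()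
    ; m₀₁₅ = nonzero 0F 1F 5F λ ()
    ; m₀₁₆ = nonzero 0F 1F 6F λ ()
    ; m₀₁₇ = nonzero 0F 1F 7F λ ()
    ; m₈₁₂ = nonzero 8F 1F 2F λ ()
    ; m₉₁₂ = nonzero 9F 1F 2F λ ()
    ; m₅₇₈ = nonzero 5F 7F 8F λ ()
    ; m₄₁₀₁₁ = nonzero 4F 10F 11F λ ()
    }

module Normalised (X : Matrix 3 13) (inc : Incidences X) where
  open Incidences inc

  a b c d : ℝ
  a = minor X 3F 1F 2F
  b = minor X 0F 3F 2F
  c = minor X 0F 1F 3F
  d = minor X 0F 1F 2F

  -- The square of `a b c` comes from the rescaling of the axes, that of `d` from Cramer's
  -- coordinates in the basis 0, 1, 2.
  κ : ℝ
  κ = a *ᴿ b *ᴿ c *ᴿ (a *ᴿ b *ᴿ c) *ᴿ (d *ᴿ d)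

  opaque
    -- Coordinates in which the points 0, 1, 2, 3 form the standard projective frame.
    y : Fin 13 → Vector ℝ
    y k = vec (b *ᴿ c *ᴿ minor X k 1F 2F) (a *ᴿ c *ᴿ minor X 0F k 2F) (a *ᴿ b *ᴿ minor X 0F 1F k)

    bracket-y : ∀ i j k → [ y i , y j , y k ] ≃ κ *ᴿ minor X i j k
    bracket-y i j k = pointwise λ l → ≡.trans
      (seq-volume (y i) (y j) (y k) l)
      (≡.trans (volume-cong (scaled l i) (scaled l j) (scaled l k))
      (≡.trans (volume-scale (seq a l) (seq b l) (seq c l) (coords l i) (coords l j) (coords l k))
      (≡.trans (≡.cong (seq a l ℚ.* seq b l ℚ.* seq c l ℚ.* (seq a l ℚ.* seq b l ℚ.* seq c l) ℚ.*_)
          (≡.trans (volume-coordinates (x l 0F) (x l 1F) (x l 2F) (x l i) (x l j) (x l k))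
            (≡.cong₂ (λ p q → p ℚ.* p ℚ.* q) (≡.sym (seq-minor 0F 1F 2F l)) (≡.sym (seq-minor i j k l)))))
        (≡.sym (ℚₚ.*-assoc (seq a l ℚ.* seq b l ℚ.* seq c l ℚ.* (seq a l ℚ.* seq b l ℚ.* seq c l))
          (seq d l ℚ.* seq d l) (seq (minor X i j k) l))))))
      where
      x : ℕ → Fin 13 → Vector ℚ
      x l k = at l (column X k)
      coords : ℕ → Fin 13 → Vector ℚ
      coords l k = coordinates (x l 0F) (x l 1F) (x l 2F) (x l k)
      seq-minor : ∀ i j k l → seq (minor X i j k) l ≡ volume (x l i) (x l j) (x l k)
      seq-minor i j k l = seq-volume (column X i) (column X j) (column X k) l
      scaled : ∀ l k i → at l (y k) i ≡
        vec (seq b l ℚ.* seq c l ℚ.* coords l k 0F) (seq a l ℚ.* seq c l ℚ.* coords l k 1F)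
            (seq a l ℚ.* seq b l ℚ.* coords l k 2F) i
      scaled l k 0F = ≡.cong (seq b l ℚ.* seq c l ℚ.*_) (seq-minor k 1F 2F l)
      scaled l k 1F = ≡.cong (seq a l ℚ.* seq c l ℚ.*_) (seq-minor 0F k 2F l)
      scaled l k 2F = ≡.cong (seq a l ℚ.* seq b l ℚ.*_) (seq-minor 0F 1F k l)

  a#0 : a #0
  a#0 = m₃₁₂
  b#0 : b #0
  b#0 = m₀₃₂
  c#0 : c #0
  c#0 = m₀₁₃
  d#0 : d #0
  d#0 = m₀₁₂

  #0-*₃ : ∀ x y z → x #0 → y #0 → z #0 → x *ᴿ y *ᴿ z #0
  #0-*₃ x y z x#0 y#0 z#0 = #0-* {x *ᴿ y} {z} (#0-* {x} {y} x#0 y#0) z#0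

  opaque
    unfolding y

    y₀#0 : ∀ k → minor X k 1F 2F #0 → y k 0F #0
    y₀#0 k = #0-*₃ b c (minor X k 1F 2F) b#0 c#0

    y₁#0 : ∀ k → minor X 0F k 2F #0 → y k 1F #0
    y₁#0 k = #0-*₃ a c (minor X 0F k 2F) a#0 c#0

    y₂#0 : ∀ k → minor X 0F 1F k #0 → y k 2F #0
    y₂#0 k = #0-*₃ a b (minor X 0F 1F k) a#0 b#0

  κ#0 : κ #0
  κ#0 = #0-* {a *ᴿ b *ᴿ c *ᴿ (a *ᴿ b *ᴿ c)} {d *ᴿ d}
    (#0-* {a *ᴿ b *ᴿ c} {a *ᴿ b *ᴿ c} (#0-*₃ a b c a#0 b#0 c#0) (#0-*₃ a b c a#0 b#0 c#0))
    (#0-* {d} {d} d#0 d#0)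

  place : ∀ i j k {u v w} → (∀ l → y i l ≃ u l) → (∀ l → y j l ≃ v l) → (∀ l → y k l ≃ w l) →
          minor X i j k ≃ 0ᴿ → [ u , v , w ] ≃ 0ᴿ
  place i j k {u} {v} {w} yi yj yk flat = begin
    [ u , v , w ]       ≈⟨ []-cong {y i} {u} {y j} {v} {y k} {w} yi yj yk ⟨
    [ y i , y j , y k ] ≈⟨ bracket-y i j k ⟩
    κ *ᴿ minor X i j k  ≈⟨ scale-zero {minor X i j k} κ flat ⟩
    0ᴿ                  ∎

  place#0 : ∀ i j k {u v w} → (∀ l → y i l ≃ u l) → (∀ l → y j l ≃ v l) → (∀ l → y k l ≃ w l) →
            minor X i j k #0 → [ u , v , w ] #0
  place#0 i j k {u} {v} {w} yi yj yk basis = #0-cong {κ *ᴿ minor X i j k} {[ u , v , w ]}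
    (≃-trans (≃-sym (bracket-y i j k)) ([]-cong {y i} {u} {y j} {v} {y k} {w} yi yj yk))
    (#0-* {κ} {minor X i j k} κ#0 basis)

  opaque
    unfolding y

    y₀ : ∀ i → y 0F i ≃ vec (y 0F 0F) 0ᴿ 0ᴿ i
    y₀ 0F = ≃-refl
    y₀ 1F = scale-zero {minor X 0F 0F 2F} (a *ᴿ c) (bracket-uuv (column X 0F) (column X 2F))
    y₀ 2F = scale-zero {minor X 0F 1F 0F} (a *ᴿ b) (bracket-uvu (column X 0F) (column X 1F))

    y₁ : ∀ i → y 1F i ≃ vec 0ᴿ (y 1F 1F) 0ᴿ i
    y₁ 0F = scale-zero {minor X 1F 1F 2F} (b *ᴿ c) (bracket-uuv (column X 1F) (column X 2F))
    y₁ 1F = ≃-refl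
    y₁ 2F = scale-zero {minor X 0F 1F 1F} (a *ᴿ b) (bracket-uvv (column X 0F) (column X 1F))

    y₂ : ∀ i → y 2F i ≃ vec 0ᴿ 0ᴿ (y 2F 2F) i
    y₂ 0F = scale-zero {minor X 2F 1F 2F} (b *ᴿ c) (bracket-uvu (column X 2F) (column X 1F))
    y₂ 1F = scale-zero {minor X 0F 2F 2F} (a *ᴿ c) (bracket-uvv (column X 0F) (column X 2F))
    y₂ 2F = ≃-refl

    y₃ : ∀ i → y 3F i ≃ vec (y 3F 0F) (y 3F 0F) (y 3F 0F) i
    y₃ 0F = ≃-refl
    y₃ 1F = pointwise λ n → solve 3 (λ a b c → a :* c :* b := b :* c :* a) ≡.refl (seq a n) (seq b n) (seq c n)
    y₃ 2F = pointwise λ n → solve 3 (λ a b c → a :* b :* c := b :* c :* a) ≡.refl (seq a n) (seq b n) (seq c n)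

  generic : ∀ k i → y k i ≃ vec (y k 0F) (y k 1F) (y k 2F) i
  generic k 0F = ≃-refl
  generic k 1F = ≃-refl
  generic k 2F = ≃-refl

  y₄ : ∀ i → y 4F i ≃ vec (y 4F 0F) (y 4F 1F) 0ᴿ i
  y₄ 0F = ≃-refl
  y₄ 1F = ≃-refl
  y₄ 2F = vanish (y 0F 0F *ᴿ y 1F 1F) (y 4F 2F)
      (#0-* {y 0F 0F} {y 1F 1F} (y₀#0 0F m₀₁₂) (y₁#0 1F m₀₁₂))
    (place 0F 1F 4F y₀ y₁ (λ _ → ≃-refl) m₀₁₄) (axes₀₁ (y 0F 0F) (y 1F 1F) (y 4F))

  y₅ : ∀ i → y 5F i ≃ vec 0ᴿ (y 5F 2F) (y 5F 2F) i
  y₅ 0F = vanish (y 1F 1F *ᴿ y 2F 2F) (y 5F 0F)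
      (#0-* {y 1F 1F} {y 2F 2F} (y₁#0 1F m₀₁₂) (y₂#0 2F m₀₁₂))
    (place 1F 2F 5F y₁ y₂ (λ _ → ≃-refl) m₁₂₅) (axes₁₂ (y 1F 1F) (y 2F 2F) (y 5F))
  y₅ 1F = ≃-sym (difference-zero {y 5F 2F} {y 5F 1F}
    (vanish (y 0F 0F *ᴿ y 3F 0F) (y 5F 2F -ᴿ y 5F 1F)
      (#0-* {y 0F 0F} {y 3F 0F} (y₀#0 0F m₀₁₂) (y₀#0 3F m₃₁₂))
    (place 0F 3F 5F y₀ y₃ (λ _ → ≃-refl) m₀₃₅) (axis-unit₀ (y 0F 0F) (y 3F 0F) (y 5F))))
  y₅ 2F = ≃-refl

  y₆ : ∀ i → y 6F i ≃ vec 0ᴿ (y 6F 1F) (y 6F 2F) i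
  y₆ 0F = vanish (y 1F 1F *ᴿ y 2F 2F) (y 6F 0F)
      (#0-* {y 1F 1F} {y 2F 2F} (y₁#0 1F m₀₁₂) (y₂#0 2F m₀₁₂))
    (place 1F 2F 6F y₁ y₂ (λ _ → ≃-refl) m₁₂₆) (axes₁₂ (y 1F 1F) (y 2F 2F) (y 6F))
  y₆ 1F = ≃-refl
  y₆ 2F = ≃-refl

  y₇ : ∀ i → y 7F i ≃ vec (y 7F 2F) (y 7F 1F) (y 7F 2F) i
  y₇ 0F = difference-zero {y 7F 0F} {y 7F 2F}
    (vanish (y 1F 1F *ᴿ y 3F 0F) (y 7F 0F -ᴿ y 7F 2F)
      (#0-* {y 1F 1F} {y 3F 0F} (y₁#0 1F m₀₁₂) (y₀#0 3F m₃₁₂))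
    (place 1F 3F 7F y₁ y₃ (λ _ → ≃-refl) m₁₃₇) (axis-unit₁ (y 1F 1F) (y 3F 0F) (y 7F)))
  y₇ 1F = ≃-refl
  y₇ 2F = ≃-refl

  y₈ : ∀ i → y 8F i ≃ vec (y 8F 0F) (y 8F 0F) (y 8F 2F) i
  y₈ 0F = ≃-refl
  y₈ 1F = difference-zero {y 8F 1F} {y 8F 0F}
    (vanish (y 2F 2F *ᴿ y 3F 0F) (y 8F 1F -ᴿ y 8F 0F)
      (#0-* {y 2F 2F} {y 3F 0F} (y₂#0 2F m₀₁₂) (y₀#0 3F m₃₁₂))
    (place 2F 3F 8F y₂ y₃ (λ _ → ≃-refl) m₂₃₈) (axis-unit₂ (y 2F 2F) (y 3F 0F) (y 8F)))
  y₈ 2F = ≃-refl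

  y₁₀ : ∀ i → y 10F i ≃ vec (y 10F 0F) 0ᴿ (y 10F 2F) i
  y₁₀ 0F = ≃-refl
  y₁₀ 1F = ≃-sym (difference-zero {0ᴿ} {y 10F 1F}
    (vanish (y 0F 0F *ᴿ y 2F 2F) (0ᴿ -ᴿ y 10F 1F)
      (#0-* {y 0F 0F} {y 2F 2F} (y₀#0 0F m₀₁₂) (y₂#0 2F m₀₁₂))
    (place 0F 2F 10F y₀ y₂ (λ _ → ≃-refl) m₀₂₁₀) (axes₀₂ (y 0F 0F) (y 2F 2F) (y 10F))))
  y₁₀ 2F = ≃-refl

  p+q#0 : y 4F 0F +ᴿ y 4F 1F #0
  p+q#0 = Elimination.p+q#0 (y 4F 0F) (y 4F 1F) (y 3F 0F) (y 5F 2F) (y 0F 0F)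
    (y 6F 1F) (y 6F 2F) (y 7F 1F) (y 7F 2F) (y 8F 0F) (y 8F 2F)
    (y 9F 0F) (y 9F 1F) (y 9F 2F) (y 10F 0F) (y 10F 2F) (y 11F 0F) (y 11F 1F) (y 11F 2F)
    (y₀#0 4F m₄₁₂) (y₁#0 4F m₀₄₂) (y₀#0 3F m₃₁₂) (y₂#0 5F m₀₁₅) (y₀#0 0F m₀₁₂)
    (y₂#0 6F m₀₁₆) (y₂#0 7F m₀₁₇)
    (y₀#0 8F m₈₁₂) (y₀#0 9F m₉₁₂)
    (place 3F 4F 6F y₃ y₄ y₆ m₃₄₆)
    (place 0F 6F 7F y₀ y₆ y₇ m₀₆₇)
    (place 4F 5F 9F y₄ y₅ (generic 9F) m₄₅₉)
    (place 7F 8F 9F y₇ y₈ (generic 9F) m₇₈₉)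
    (place 3F 9F 10F y₃ (generic 9F) y₁₀ m₃₉₁₀)
    (place 0F 8F 11F y₀ y₈ (generic 11F) m₀₈₁₁)
    (place 5F 7F 11F y₅ y₇ (generic 11F) m₅₇₁₁)
    (place#0 5F 7F 8F y₅ y₇ y₈ m₅₇₈)
    (place#0 4F 10F 11F y₄ y₁₀ (generic 11F) m₄₁₀₁₁)

  -- With `p`, `q` the minors [4 1 2], [0 4 2], point 4 is (c b p, c a q, 0) in frame coordinates.
  -- Apartness of its coordinate sum therefore gives that of the factor `b p + a q`.
  discriminant#0 : fun discriminant X #0
  discriminant#0 = #0-cong (pointwise λ n → ≡.sym (seq-discriminant X n))
    (#0-* {bp} {bp +ᴿ aq} (#0-* {b} {minor X 4F 1F 2F} b#0 m₄₁₂) (#0-*⁻ʳ {c} {bp +ᴿ aq} (#0-cong factor p+q#0)))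
    where
    bp aq : ℝ
    bp = b *ᴿ minor X 4F 1F 2F
    aq = a *ᴿ minor X 0F 4F 2F
    opaque
      unfolding y
      factor : y 4F 0F +ᴿ y 4F 1F ≃ c *ᴿ (bp +ᴿ aq)
      factor = pointwise λ n → solve 5 (λ a b c p q →
          b :* c :* p :+ a :* c :* q := c :* (b :* p :+ a :* q)) ≡.refl
        (seq a n) (seq b n) (seq c n) (seq (minor X 4F 1F 2F) n) (seq (minor X 0F 4F 2F) n)

-- The oriented matroid and its realizations.

HasSign-zer : ∀ x {s} → HasSign x s → s ≡ zer → x ≃ 0ᴿ
HasSign-zer x x≈0 ≡.refl = ⟪ x≈0 ⟫

HasSign-#0 : ∀ x s → HasSign x s → s ≢ zer → x #0
HasSign-#0 x neg x<0 _ = 0<-neg⇒#0 {x} (<ᴿ0⇒0<-neg {x} x<0)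
HasSign-#0 x zer _ zer≢zer = contradiction ≡.refl zer≢zer
HasSign-#0 x pos 0<x _ = 0<⇒#0 (0<ᴿ⇒0< {x} 0<x)

opp-zer : ∀ s → opp s ≡ zer → s ≡ zer
opp-zer zer _ = ≡.refl

matroid : OrientedMatroid 3 13
matroid = vectorMatroid points₊ (triple 0F 1F 2F , basis)
  where
  opaque
    unfolding volume
    basis : chirotope points₊ (triple 0F 1F 2F) ≢ zer
    basis ()

HasChirotope⇒Incidences : ∀ (X : Matrix 3 13) (χ : Vec (Fin 13) 3 → Sgn) → HasChirotope X χ →
  (∀ s → chirotope points₊ s ≡ zer → χ s ≡ zer) →
  (∀ s → χ s ≡ zer → chirotope points₊ s ≡ zer) → Incidences X
HasChirotope⇒Incidences X χ X-χ to from = incidences X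
  (λ i j k χ≡0 → ≃-trans (≃-sym (det≃minor X i j k))
    (HasSign-zer (maximalMinor X (triple i j k)) {χ (triple i j k)}
      (X-χ′ (triple i j k)) (to (triple i j k) χ≡0)))
  (λ i j k χ≢0 → #0-cong (det≃minor X i j k)
    (HasSign-#0 (maximalMinor X (triple i j k)) (χ (triple i j k))
      (X-χ′ (triple i j k)) (χ≢0 ∘ from (triple i j k))))
  where
  X-χ′ : ∀ s → HasSign (maximalMinor X s) (χ s)
  X-χ′ = HasChirotope⇒HasSign X χ X-χ

realization-incidences : ∀ X → IsRealization matroid X → Incidences X
realization-incidences X (_ , inj₁ X-χ) =
  HasChirotope⇒Incidences X (chirotope points₊) X-χ (λ _ χ≡0 → χ≡0) (λ _ χ≡0 → χ≡0)
realization-incidences X (_ , inj₂ X-χ) =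
  HasChirotope⇒Incidences X (λ s → opp (chirotope points₊ s)) X-χ
  (λ _ → ≡.cong opp) (λ s → opp-zer (chirotope points₊ s))

StandardBasis : ∀ {n} → (Fin (3 ℕ.+ n) → Vector ℚ) → Set
StandardBasis x = ∀ i →
  (x 0F i ≡ vec 1ℚ 0ℚ 0ℚ i) × (x 1F i ≡ vec 0ℚ 1ℚ 0ℚ i) × (x 2F i ≡ vec 0ℚ 0ℚ 1ℚ i)

combination-standard : ∀ {n} (x : Fin (3 ℕ.+ n) → Vector ℚ) → StandardBasis x →
  ∀ i (a : Vector ℚ) →
  x 0F i ℚ.* a 0F ℚ.+ (x 1F i ℚ.* a 1F ℚ.+ (x 2F i ℚ.* a 2F ℚ.+ 0ℚ)) ≡ a i
combination-standard x basis i a with basis i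
... | x₀ , x₁ , x₂ = ≡.trans
    (≡.cong₂ ℚ._+_ (≡.cong (ℚ._* a 0F) x₀)
      (≡.cong₂ ℚ._+_ (≡.cong (ℚ._* a 1F) x₁) (≡.cong (λ e → e ℚ.* a 2F ℚ.+ 0ℚ) x₂)))
    (unit i)
  where
  unit : ∀ i → vec 1ℚ 0ℚ 0ℚ i ℚ.* a 0F ℚ.+
         (vec 0ℚ 1ℚ 0ℚ i ℚ.* a 1F ℚ.+ (vec 0ℚ 0ℚ 1ℚ i ℚ.* a 2F ℚ.+ 0ℚ)) ≡ a i
  unit 0F = solve 3 (λ a b c → con 1ℚ :* a :+ (con 0ℚ :* b :+ (con 0ℚ :* c :+ con 0ℚ)) := a)
    ≡.refl (a 0F) (a 1F) (a 2F)
  unit 1F = solve 3 (λ a b c → con 0ℚ :* a :+ (con 1ℚ :* b :+ (con 0ℚ :* c :+ con 0ℚ)) := b)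
    ≡.refl (a 0F) (a 1F) (a 2F)
  unit 2F = solve 3 (λ a b c → con 0ℚ :* a :+ (con 0ℚ :* b :+ (con 1ℚ :* c :+ con 0ℚ)) := c)
    ≡.refl (a 0F) (a 1F) (a 2F)

-- Relative to the standard basis in the first three columns every vector is its own coefficient
-- vector, which gives independence and spanning at once.
standard-HasRank : ∀ {n} (x : Fin (3 ℕ.+ n) → Vector ℚ) → StandardBasis x → HasRank (matrix x) 3
standard-HasRank x basis = triple 0F 1F 2F
  , (λ a combination≈0 i → close (≃-trans (≃-sym (combination≃ a i))
      (⟪_⟫ {y = 0ᴿ} (combination≈0 i))))
  , (λ j → column (matrix x) j , λ i → close (≃-sym (combination≃ (column (matrix x) j) i)))
  where
  combination≃ : ∀ (a : Vector ℝ) i →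
    matrix x i 0F *ᴿ a 0F +ᴿ (matrix x i 1F *ᴿ a 1F +ᴿ (matrix x i 2F *ᴿ a 2F +ᴿ 0ᴿ)) ≃ a i
  combination≃ a i = pointwise λ n → combination-standard x basis i (at n a)

-- The two open sets.

region : ∀ f → SemiInvariant f → Subset (Space.points (realizationSpace matroid))
mem  (region f f-⊠) (X , _) = 0< fun f X
resp (region f f-⊠) {X , _} {Y , _} = 0<-LinearlyEquivalent f f-⊠ {X} {Y}

-- The same inequality on the whole matrix space defines an open set, and the region is its trace on
-- the realizations.
region-open : ∀ f f-⊠ → Space.Open (realizationSpace matroid) (region f f-⊠)
region-open f f-⊠ = record
    { mem  = λ X → 0< fun f X
    ; resp = λ {X} {Y} X≋Y → 0<-cong (fun-cong f {X} {Y} X≋Y)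
    }
  , 0<-open f
  , λ _ → mk⇔ id id

points₊-realization : IsRealization matroid (matrix points₊)
points₊-realization = standard-HasRank points₊
      (λ { 0F → ≡.refl , ≡.refl , ≡.refl ; 1F → ≡.refl , ≡.refl , ≡.refl ; 2F → ≡.refl , ≡.refl , ≡.refl })
  , inj₁ (HasSign⇒HasChirotope (matrix points₊) (chirotope points₊) λ s →
      HasSign-≃ (maximalMinor (matrix points₊) s) (chirotope points₊ s) (det-matrix points₊ s)
        (isSign _))

points₋-realization : IsRealization matroid (matrix points₋)
points₋-realization = standard-HasRank points₋
      (λ { 0F → ≡.refl , ≡.refl , ≡.refl ; 1F → ≡.refl , ≡.refl , ≡.refl ; 2F → ≡.refl , ≡.refl , ≡.refl })
  , inj₁ (HasSign⇒HasChirotope (matrix points₋) (chirotope points₊) λ s →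
      HasSign-≃ (maximalMinor (matrix points₋) s) (chirotope points₊ s) (det-matrix points₋ s)
        (≡.subst (IsSign _) (≡.sym (same-orientation (lookup s 0F) (lookup s 1F) (lookup s 2F)))
          (isSign _)))

discriminantℚ : (Fin 13 → Vector ℚ) → ℚ
discriminantℚ x = form (vol 0F 3F 2F) (vol 4F 1F 2F) (vol 3F 1F 2F) (vol 0F 4F 2F)
  where
  vol : Fin 13 → Fin 13 → Fin 13 → ℚ
  vol i j k = volume (x i) (x j) (x k)

discriminant-matrix : ∀ x → fun discriminant (matrix x) ≃ fromℚ (discriminantℚ x)
discriminant-matrix x = pointwise λ n → ≡.trans (seq-discriminant (matrix x) n)
  (form-cong (seq-minor n 0F 3F 2F) (seq-minor n 4F 1F 2F) (seq-minor n 3F 1F 2F) (seq-minor n 0F 4F 2F))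
  where
  seq-minor : ∀ n i j k → seq (minor (matrix x) i j k) n ≡ volume (x i) (x j) (x k)
  seq-minor n i j k = seq-volume (column (matrix x) i) (column (matrix x) j) (column (matrix x) k) n

opaque
  unfolding volume

  0<discriminant-points₊ : 0ℚ ℚ.< discriminantℚ points₊
  0<discriminant-points₊ = from-yes (0ℚ ℚₚ.<? discriminantℚ points₊)

  0<-discriminant-points₋ : 0ℚ ℚ.< ℚ.- discriminantℚ points₋
  0<-discriminant-points₋ = from-yes (0ℚ ℚₚ.<? ℚ.- discriminantℚ points₋)

0<-discriminant-points₊ : 0< fun discriminant (matrix points₊)
0<-discriminant-points₊ = 0<-cong (≃-sym (discriminant-matrix points₊)) (0<-fromℚ 0<discriminant-points₊)

0<-⊖discriminant-points₋ : 0< fun (⊖ discriminant) (matrix points₋)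
0<-⊖discriminant-points₋ = 0<-cong
  (≃-trans (fromℚ-neg (discriminantℚ points₋))
    (neg-cong {fromℚ (discriminantℚ points₋)} {fun discriminant (matrix points₋)}
      (≃-sym (discriminant-matrix points₋))))
  (0<-fromℚ 0<-discriminant-points₋)

discriminant-disjoint : ∀ X → ¬ (0< fun discriminant X × 0< fun (⊖ discriminant) X)
discriminant-disjoint X (0<D , D<0) = ¬0<∧0<-neg {fun discriminant X} 0<D D<0

discriminant-cover : ∀ X → IsRealization matroid X → 0< fun discriminant X ⊎ 0< fun (⊖ discriminant) X
discriminant-cover X real = #0⇒0< {fun discriminant X}
  (Normalised.discriminant#0 X (realization-incidences X real))

theorem1p3 : Σ[ M ∈ OrientedMatroid 3 13 ] Disconnected (realizationSpace M)
theorem1p3 = matroid , record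
  { U          = region discriminant discriminant-⊠
  ; V          = region (⊖ discriminant) (⊖-semiInvariant discriminant discriminant-⊠)
  ; U-open     = region-open discriminant discriminant-⊠
  ; V-open     = region-open (⊖ discriminant) (⊖-semiInvariant discriminant discriminant-⊠)
  ; U-nonempty = (matrix points₊ , points₊-realization) , 0<-discriminant-points₊
  ; V-nonempty = (matrix points₋ , points₋-realization) , 0<-⊖discriminant-points₋
  ; disjoint   = λ (X , _) → discriminant-disjoint X
  ; cover      = λ (X , real) → discriminant-cover X real
  }
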